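{- Let $\mathcal{C}$ be a class of graphs each of which is a complete $d$-partite graph $K_{m_0,\dots,m_{d-1}}$ for some $d\in\mathbb N$ (the number $d$ may differ from graph to graph). The following statements are equivalent: (1) $\mathcal C$ is $\mathrm{MSO}_2$-orderable. (2) There exists a constant $s$ such that $\mathcal C$ has property $\mathsf{SEP}(f)$ where $f(k)=2^{s(k+1)}$. (3) There exists a constant $s$ such that $K_{m_0,\dots,m_{d-1}}\in\mathcal C$ implies $M\le 2^{s(N-M+1)}$, where $M:=\max_{i<d}m_i$ and $N:=\sum_{i<d}m_i$.
   Context: $K_{m_0,\dots,m_{d-1}}$ denotes the complete $d$-partite graph with parts of sizes $m_0,\dots,m_{d-1}$. Graphs are finite, simple, undirected. For a graph $G=\langle V,E\rangle$, $\lceil G\rceil=\langle V\cup E,\mathrm{inc}\rangle$ is the structure with universe $V\cup E$ and vertex–edge incidence relation. A class of graphs is $\mathrm{MSO}_2$-orderable if there is an MSO-formula $\varphi(x,y;\bar Z)$ ($\bar Z$ set variables) such that for every nonempty $G$ in the class there are sets $\bar P\subseteq V\cup E$ for which $\{(a,b):\lceil G\rceil\models\varphi(a,b;\bar P)\}$ is a linear order on $V\cup E$. $\mathrm{Sep}(G,k)$ is the maximal number of connected components of $G-S$ over vertex sets $S$ with $|S|\le k$; a class has property $\mathsf{SEP}(f)$ if $\mathrm{Sep}(G,k)\le f(k)$ for all its members $G$ and all $k\in\mathbb N$. -}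

module Defs where

open import Data.Bool using (Bool; true; false; _∧_; _∨_; not; if_then_else_)
open import Data.Nat using (ℕ; zero; suc; _+_; _*_; _∸_; _^_; _≤_; _<_; _⊔_; _≡ᵇ_; _<ᵇ_)
open import Data.Fin using (Fin; toℕ; splitAt)
open import Data.List using (List; []; _∷_; length; filterᵇ; concatMap; allFin; lookup; foldr)
open import Data.Bool.ListAction using (any; all)
open import Data.Vec.Functional using () renaming (_∷_ to _∷ᶠ_; [] to []ᶠ)
open import Data.Nat.ListAction using (sum)
open import Data.Product using (Σ; _×_; _,_; proj₁; proj₂)
open import Data.Sum using (inj₁; inj₂)
open import Relation.Binary.PropositionalEquality using (_≡_)
open import Relation.Binary.Structures using (IsTotalOrder)

record Graph : Set where
  field
    n      : ℕ
    adj    : Fin n → Fin n → Bool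
    sym    : ∀ u v → adj u v ≡ adj v u
    irrefl : ∀ v → adj v v ≡ false
open Graph public

_==_ : ∀ {n} → Fin n → Fin n → Bool
u == v = toℕ u ≡ᵇ toℕ v

-- Complete multipartite graph K_{m_0,...,m_{d-1}}, given by the list
-- m = m_0 ∷ ... ∷ m_{d-1}; vertex set Fin (m_0 + ... + m_{d-1}),
-- the first m_0 vertices form part 0, the next m_1 part 1, etc.

partOf : (m : List ℕ) → Fin (sum m) → ℕ
partOf []       ()
partOf (a ∷ ms) v with splitAt a v
... | inj₁ _ = 0
... | inj₂ w = suc (partOf ms w)

private
  ≡ᵇ-sym : ∀ a b → (a ≡ᵇ b) ≡ (b ≡ᵇ a)
  ≡ᵇ-sym zero zero = Relation.Binary.PropositionalEquality.refl
  ≡ᵇ-sym zero (suc b) = Relation.Binary.PropositionalEquality.refl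
  ≡ᵇ-sym (suc a) zero = Relation.Binary.PropositionalEquality.refl
  ≡ᵇ-sym (suc a) (suc b) = ≡ᵇ-sym a b

  ≡ᵇ-refl : ∀ a → (a ≡ᵇ a) ≡ true
  ≡ᵇ-refl zero = Relation.Binary.PropositionalEquality.refl
  ≡ᵇ-refl (suc a) = ≡ᵇ-refl a

  notCong : ∀ {a b} → a ≡ b → not a ≡ not b
  notCong Relation.Binary.PropositionalEquality.refl = Relation.Binary.PropositionalEquality.refl

  notTrue : ∀ {a} → a ≡ true → not a ≡ false
  notTrue Relation.Binary.PropositionalEquality.refl = Relation.Binary.PropositionalEquality.refl

K : List ℕ → Graph
K m = record
  { n      = sum m
  ; adj    = λ u v → not (partOf m u ≡ᵇ partOf m v)
  ; sym    = λ u v → notCong (≡ᵇ-sym (partOf m u) (partOf m v))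
  ; irrefl = λ v → notTrue (≡ᵇ-refl (partOf m v))
  }

record Structure : Set where
  field
    size : ℕ
    rel  : Fin size → Fin size → Bool
open Structure public

edges : (G : Graph) → List (Fin (n G) × Fin (n G))
edges G = concatMap (λ i → filterᵇ (λ e → (toℕ (proj₁ e) <ᵇ toℕ (proj₂ e)) ∧ adj G (proj₁ e) (proj₂ e))
                                    (Data.List.map (λ j → i , j) (allFin (n G))))
                    (allFin (n G))

-- ⌈G⌉ = ⟨V ∪ E, inc⟩ : universe Fin (|V| + |E|), first the vertices,
-- then the edges; inc(a, b) holds iff a is a vertex, b an edge, and a is
-- an endpoint of b.
⌈_⌉ : Graph → Structure
⌈ G ⌉ = record
  { size = n G + length (edges G)
  ; rel  = λ a b → inc (splitAt (n G) a) (splitAt (n G) b)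
  }
  where
    open import Data.Sum using (_⊎_)
    inc : Fin (n G) ⊎ Fin (length (edges G)) → Fin (n G) ⊎ Fin (length (edges G)) → Bool
    inc (inj₁ v) (inj₂ e) = (v == proj₁ (lookup (edges G) e)) ∨ (v == proj₂ (lookup (edges G) e))
    inc _        _        = false

-- MSO formulas with i free element variables and j free set variables
-- (de Bruijn style), over the signature with one binary relation symbol.

data Formula : ℕ → ℕ → Set where
  R    : ∀ {i j} → Fin i → Fin i → Formula i j
  Eq   : ∀ {i j} → Fin i → Fin i → Formula i j
  Mem  : ∀ {i j} → Fin i → Fin j → Formula i j
  Not  : ∀ {i j} → Formula i j → Formula i j
  And  : ∀ {i j} → Formula i j → Formula i j → Formula i j
  Or   : ∀ {i j} → Formula i j → Formula i j → Formula i j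
  Ex   : ∀ {i j} → Formula (suc i) j → Formula i j
  All  : ∀ {i j} → Formula (suc i) j → Formula i j
  ExS  : ∀ {i j} → Formula i (suc j) → Formula i j
  AllS : ∀ {i j} → Formula i (suc j) → Formula i j

allSubsets : (n : ℕ) → List (Fin n → Bool)
allSubsets zero    = (λ ()) ∷ []
allSubsets (suc n) = concatMap (λ S → (false ∷ᶠ S) ∷ (true ∷ᶠ S) ∷ []) (allSubsets n)

eval : (A : Structure) → ∀ {i j} → Formula i j →
       (Fin i → Fin (size A)) → (Fin j → Fin (size A) → Bool) → Bool
eval A (R x y)    ρ σ = rel A (ρ x) (ρ y)
eval A (Eq x y)   ρ σ = ρ x == ρ y
eval A (Mem x Z)  ρ σ = σ Z (ρ x)
eval A (Not φ)    ρ σ = not (eval A φ ρ σ)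
eval A (And φ ψ)  ρ σ = eval A φ ρ σ ∧ eval A ψ ρ σ
eval A (Or φ ψ)   ρ σ = eval A φ ρ σ ∨ eval A ψ ρ σ
eval A (Ex φ)     ρ σ = any (λ a → eval A φ (a ∷ᶠ ρ) σ) (allFin (size A))
eval A (All φ)    ρ σ = all (λ a → eval A φ (a ∷ᶠ ρ) σ) (allFin (size A))
eval A (ExS φ)    ρ σ = any (λ P → eval A φ ρ (P ∷ᶠ σ)) (allSubsets (size A))
eval A (AllS φ)   ρ σ = all (λ P → eval A φ ρ (P ∷ᶠ σ)) (allSubsets (size A))

MSO₂-orderable : (List ℕ → Set) → Set
MSO₂-orderable C =
  Σ ℕ λ k → Σ (Formula 2 k) λ φ →
    ∀ m → C m → 0 < sum m →
      Σ (Fin k → Fin (size ⌈ K m ⌉) → Bool) λ P →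
        IsTotalOrder _≡_ (λ a b → eval ⌈ K m ⌉ φ (a ∷ᶠ b ∷ᶠ []ᶠ) P ≡ true)

card : ∀ {n} → (Fin n → Bool) → ℕ
card {n} S = length (filterᵇ S (allFin n))

reachIter : (G : Graph) → (Fin (n G) → Bool) → ℕ → Fin (n G) → Fin (n G) → Bool
reachIter G S zero    u v = not (S u) ∧ (u == v)
reachIter G S (suc t) u v =
  reachIter G S t u v ∨ any (λ w → reachIter G S t u w ∧ adj G w v ∧ not (S v)) (allFin (n G))

connectedIn : (G : Graph) → (Fin (n G) → Bool) → Fin (n G) → Fin (n G) → Bool
connectedIn G S = reachIter G S (n G)

-- number of connected components of G - S (counted via their least vertex)
components : (G : Graph) → (Fin (n G) → Bool) → ℕ
components G S =
  length (filterᵇ (λ v → not (S v) ∧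
                         all (λ u → not ((toℕ u <ᵇ toℕ v) ∧ connectedIn G S u v)) (allFin (n G)))
                  (allFin (n G)))

SEP : (ℕ → ℕ) → Graph → Set
SEP f G = ∀ k (S : Fin (n G) → Bool) → card S ≤ k → components G S ≤ f k

SEP-class : (List ℕ → Set) → Set
SEP-class C = Σ ℕ λ s → ∀ m → C m → SEP (λ k → 2 ^ (s * (k + 1))) (K m)

maxPart : List ℕ → ℕ
maxPart = foldr _⊔_ 0

Bounded : (List ℕ → Set) → Set
Bounded C = Σ ℕ λ s → ∀ m → C m → maxPart m ≤ 2 ^ (s * (sum m ∸ maxPart m + 1))

-- (2) ⇔ (3): deleting everything outside a largest part leaves M isolated vertices, while G - S is
-- connected as soon as it meets two parts.
--
-- (1) ⇒ (3): colour a vertex a of a largest part by the traces of the k parameters on a and on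
-- the edges at a.  Two vertices of that part with the same colour are exchanged by an automorphism
-- fixing the parameters, so a definable order could not separate them; hence M ≤ 2^(k(N-M+1)).
--
-- (3) ⇒ (1): group the parts around a median part into a vertex set U and its complement W such
-- that |U| ≤ |W| + 1 and |W| ≤ 2^(t(|U|+1)).  All U–W edges exist, so one edge set can encode a
-- half-graph that orders U by inclusion of neighbourhoods, and t further sets of vertices and edges
-- give each w ∈ W its own binary code with digits at w and at the edges from w to U, which orders W
-- lexicographically.  Edges are then ordered by their endpoints.  The defining formula is
-- first-order.
module Submission where

open import Defs
open import Data.List using (List)
open import Data.Nat using (ℕ)
open import Data.Product using (_×_)
open import Function.Bundles using (_⇔_)

open import Data.Bool using (Bool; true; false; _∧_; _∨_; not; T; T?; if_then_else_)
import Data.Bool as Bool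
open import Data.Bool.ListAction using (any; all)
open import Data.Bool.Properties using (T-≡; ∨-zeroʳ; ∨-identityʳ; ¬-not; not-injective)
open import Data.Fin using (Fin; zero; suc; toℕ; fromℕ<; splitAt; _↑ˡ_; _↑ʳ_; remQuot; combine; funToFin; finToFun)
open import Data.Fin.Properties as Fin using (toℕ-injective; toℕ<n; toℕ-fromℕ<; splitAt-↑ˡ; splitAt-↑ʳ; join-splitAt; ↑ˡ-injective; finToFun-funToFin; funToFin-finToFin; remQuot-combine; combine-remQuot; pigeonhole; any?; all?; ¬∀⟶∃¬)
open import Data.List using ([]; _∷_; allFin; length; lookup; filterᵇ; map; tabulate)
open import Data.List.Membership.Propositional using (_∈_; lose; find)
open import Data.List.Membership.Propositional.Properties using (∈-allFin; ∈-concatMap⁺; ∈-concatMap⁻; ∈-filter⁺; ∈-filter⁻; ∈-map⁺; ∈-map⁻; ∈-lookup)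
import Data.List.Relation.Unary.All as All
import Data.List.Relation.Unary.All.Properties as All
open import Data.List.Relation.Unary.AllPairs as AllPairs using (_∷_)
import Data.List.Relation.Unary.AllPairs.Properties as AllPairs
open import Data.List.Relation.Unary.Any as Any using (Any; here; there)
import Data.List.Relation.Unary.Any.Properties as Any
open import Data.List.Relation.Unary.Unique.Propositional using (Unique)
import Data.List.Relation.Unary.Unique.Propositional.Properties as Unique
open import Data.Nat using (zero; suc; _+_; _*_; _∸_; _^_; _⊔_; _≤_; _<_; z≤n; s≤s; s≤s⁻¹; _≤′_; ≤′-reflexive; ≤′-step; _≤?_; _<?_; _≟_; _≡ᵇ_; _<ᵇ_)
open import Data.Nat.ListAction using (sum)
open import Data.Nat.Properties hiding (_≤?_; _<?_; _≟_)
open import Data.Nat.Tactic.RingSolver using (solve-∀)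
open import Data.Product using (∃-syntax; _,_; proj₁; proj₂; uncurry)
open import Data.Sum as Sum using (_⊎_; inj₁; inj₂; [_,_]′)
open import Data.Unit using (⊤; tt)
open import Data.Vec.Functional using () renaming (_∷_ to _∷ᶠ_; [] to []ᶠ)
open import Function using (_∘_; id; const; flip; Equivalence; mk⇔)
open import Relation.Binary.Definitions using (tri<; tri≈; tri>)
open import Relation.Binary.PropositionalEquality as ≡ using (_≡_; _≢_; refl; cong; cong₂; trans; subst; subst₂)
open import Relation.Binary.Structures using (IsTotalOrder)
open import Relation.Nullary using (¬_; Dec; yes; no; contradiction)
open import Relation.Nullary.Decidable using (¬?; _⊎-dec_; _×-dec_; decidable-stable)
open import Algebra.Properties.CommutativeSemigroup +-commutativeSemigroup using (interchange; x∙yz≈y∙xz)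

-- Semantics of MSO formulas

-- The exponent `N - M + 1` counts the places that can carry information about one vertex of a
-- largest part: the vertex itself and its edges to the other parts. The construction has the same
-- supply: `|U| + 1` places per set for each vertex of `W`, hence `t * (|U| + 1)` digits. To read
-- digits at edges as a word, `U` must be ordered beforehand, and a part has no inner edges to do
-- so. Inclusion of neighbourhoods needs no prior order. A strict chain of `|U|` neighbourhoods that
-- begins with the empty one takes `|U| - 1` vertices of `W`; hence the condition `|U| ≤ |W| + 1`.
-- The size of `W` has two sources. If the median part is at least as large as all the rest, it
-- becomes `W`, and only the hypothesis with its constant `s` bounds it. Otherwise `|W| ≤ 3|U|`, for
-- which two digit sets suffice. The choice `t = 2 + s` covers both. The words have length depending
-- on the graph, so a formula of fixed size cannot unfold their lexicographic comparison; it is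
-- rephrased with quantifiers over positions.

to-T : ∀ {b} → b ≡ true → T b
to-T = Equivalence.from T-≡

from-T : ∀ {b} → T b → b ≡ true
from-T = Equivalence.to T-≡

bool-ext : ∀ {a b} → (a ≡ true → b ≡ true) → (b ≡ true → a ≡ true) → a ≡ b
bool-ext {false} {false} f g = refl
bool-ext {false} {true}  f g = g refl
bool-ext {true}  {false} f g = ≡.sym (f refl)
bool-ext {true}  {true}  f g = refl

true≢false : ∀ {b} → b ≡ true → ¬ b ≡ false
true≢false refl ()

∧-true : ∀ a {b} → a ∧ b ≡ true → a ≡ true × b ≡ true
∧-true true eq = refl , eq

∨-true : ∀ a {b} → a ∨ b ≡ true → a ≡ true ⊎ b ≡ true
∨-true true  eq = inj₁ refl
∨-true false eq = inj₂ eq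

∨-introʳ : ∀ a {b} → b ≡ true → a ∨ b ≡ true
∨-introʳ a refl = ∨-zeroʳ a

∨-introˡ : ∀ {a} b → a ≡ true → a ∨ b ≡ true
∨-introˡ b refl = refl

∧-intro : ∀ {a b} → a ≡ true → b ≡ true → a ∧ b ≡ true
∧-intro refl refl = refl

not-true : ∀ {a} → not a ≡ true → a ≡ false
not-true {false} eq = refl

not-intro : ∀ {a} → a ≡ false → not a ≡ true
not-intro refl = refl

≡ᵇ-true : ∀ {a b} → (a ≡ᵇ b) ≡ true → a ≡ b
≡ᵇ-true {a} {b} eq = ≡ᵇ⇒≡ a b (to-T eq)

≡ᵇ-intro : ∀ {a b} → a ≡ b → (a ≡ᵇ b) ≡ true
≡ᵇ-intro {a} {b} eq = from-T (≡⇒≡ᵇ a b eq)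

==-true : ∀ {n} {u v : Fin n} → (u == v) ≡ true → u ≡ v
==-true eq = toℕ-injective (≡ᵇ-true eq)

==-intro : ∀ {n} {u v : Fin n} → u ≡ v → (u == v) ≡ true
==-intro eq = ≡ᵇ-intro (cong toℕ eq)

module _ {A : Set} (p : A → Bool) where

  any-intro : ∀ xs → Any (λ x → p x ≡ true) xs → any p xs ≡ true
  any-intro xs h = from-T (Any.any⁺ p (Any.map to-T h))

  any-true : ∀ xs → any p xs ≡ true → Any (λ x → p x ≡ true) xs
  any-true xs h = Any.map from-T (Any.any⁻ p xs (to-T h))

  all-intro : ∀ xs → All.All (λ x → p x ≡ true) xs → all p xs ≡ true
  all-intro xs h = from-T (All.all⁻ p (All.map to-T h))

  all-true : ∀ xs → all p xs ≡ true → All.All (λ x → p x ≡ true) xs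
  all-true xs h = All.map from-T (All.all⁺ p xs (to-T h))

-- Propositional reading used in all arguments about formulas. Its set quantifiers range over all
-- Boolean functions, whereas `eval` runs through a list that contains each subset only up to
-- pointwise equality.
Sat : (A : Structure) → ∀ {i j} → Formula i j →
      (Fin i → Fin (size A)) → (Fin j → Fin (size A) → Bool) → Set
Sat A (R x y)   ρ σ = rel A (ρ x) (ρ y) ≡ true
Sat A (Eq x y)  ρ σ = ρ x ≡ ρ y
Sat A (Mem x Z) ρ σ = σ Z (ρ x) ≡ true
Sat A (Not φ)   ρ σ = ¬ Sat A φ ρ σ
Sat A (And φ ψ) ρ σ = Sat A φ ρ σ × Sat A ψ ρ σ
Sat A (Or φ ψ)  ρ σ = Sat A φ ρ σ ⊎ Sat A ψ ρ σ
Sat A (Ex φ)    ρ σ = ∃[ a ] Sat A φ (a ∷ᶠ ρ) σ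
Sat A (All φ)   ρ σ = ∀ a → Sat A φ (a ∷ᶠ ρ) σ
Sat A (ExS φ)   ρ σ = ∃[ P ] Sat A φ ρ (P ∷ᶠ σ)
Sat A (AllS φ)  ρ σ = ∀ P → Sat A φ ρ (P ∷ᶠ σ)

module _ {A : Structure} {Π : Fin (size A) → Fin (size A)}
         (invol : (a : Fin (size A)) → Π (Π a) ≡ a)
         (rel-Π : (a b : Fin (size A)) → rel A (Π a) (Π b) ≡ rel A a b) where

  -- Truth is invariant under automorphisms. An involution is its own inverse, so negation and the
  -- universal quantifiers reuse `Π`. Comparing sets pointwise replaces function extensionality.
  Sat-involution : ∀ {i j} (φ : Formula i j) {ρ ρ′ σ σ′} →
    (∀ x → ρ′ x ≡ Π (ρ x)) → (∀ Z a → σ′ Z (Π a) ≡ σ Z a) →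
    Sat A φ ρ σ → Sat A φ ρ′ σ′

  private
    ρ-sym : ∀ {i} {ρ ρ′ : Fin i → Fin (size A)} →
      (∀ x → ρ′ x ≡ Π (ρ x)) → ∀ x → ρ x ≡ Π (ρ′ x)
    ρ-sym hρ x = trans (≡.sym (invol _)) (cong Π (≡.sym (hρ x)))

    σ-sym : ∀ {j} {σ σ′ : Fin j → Fin (size A) → Bool} →
      (∀ Z a → σ′ Z (Π a) ≡ σ Z a) → ∀ Z a → σ Z (Π a) ≡ σ′ Z a
    σ-sym {σ′ = σ′} hσ Z a = trans (≡.sym (hσ Z (Π a))) (cong (σ′ Z) (invol a))

    ρ-∷ : ∀ {i} {ρ ρ′ : Fin i → Fin (size A)} {a b} → b ≡ Π a →
      (∀ x → ρ′ x ≡ Π (ρ x)) → ∀ x → (b ∷ᶠ ρ′) x ≡ Π ((a ∷ᶠ ρ) x)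
    ρ-∷ eq hρ zero    = eq
    ρ-∷ eq hρ (suc x) = hρ x

    σ-∷ : ∀ {j} {σ σ′ : Fin j → Fin (size A) → Bool} {P Q} → (∀ a → Q (Π a) ≡ P a) →
      (∀ Z a → σ′ Z (Π a) ≡ σ Z a) → ∀ Z a → (Q ∷ᶠ σ′) Z (Π a) ≡ (P ∷ᶠ σ) Z a
    σ-∷ eq hσ zero    = eq
    σ-∷ eq hσ (suc Z) = hσ Z

  Sat-involution (R x y) hρ hσ h =
    trans (cong₂ (rel A) (hρ x) (hρ y)) (trans (rel-Π _ _) h)
  Sat-involution (Eq x y) hρ hσ h = trans (hρ x) (trans (cong Π h) (≡.sym (hρ y)))
  Sat-involution (Mem x Z) {σ′ = σ′} hρ hσ h =
    trans (cong (σ′ Z) (hρ x)) (trans (hσ Z _) h)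
  Sat-involution (Not φ) hρ hσ h h′ = h (Sat-involution φ (ρ-sym hρ) (σ-sym hσ) h′)
  Sat-involution (And φ ψ) hρ hσ (h , k) =
    Sat-involution φ hρ hσ h , Sat-involution ψ hρ hσ k
  Sat-involution (Or φ ψ) hρ hσ (inj₁ h) = inj₁ (Sat-involution φ hρ hσ h)
  Sat-involution (Or φ ψ) hρ hσ (inj₂ h) = inj₂ (Sat-involution ψ hρ hσ h)
  Sat-involution (Ex φ) hρ hσ (a , h) = Π a , Sat-involution φ (ρ-∷ refl hρ) hσ h
  Sat-involution (All φ) hρ hσ h a =
    Sat-involution φ (ρ-∷ (≡.sym (invol a)) hρ) hσ (h (Π a))
  Sat-involution (ExS φ) hρ hσ (P , h) =
    P ∘ Π , Sat-involution φ hρ (σ-∷ (cong P ∘ invol) hσ) h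
  Sat-involution (AllS φ) hρ hσ h P =
    Sat-involution φ hρ (σ-∷ (λ _ → refl) hσ) (h (P ∘ Π))

Sat-cong : ∀ (A : Structure) {i j} (φ : Formula i j) {ρ ρ′ σ σ′} →
  (∀ x → ρ′ x ≡ ρ x) → (∀ Z a → σ′ Z a ≡ σ Z a) → Sat A φ ρ σ → Sat A φ ρ′ σ′
Sat-cong A φ = Sat-involution {A} (λ _ → refl) (λ _ _ → refl) φ

allSubsets-complete : ∀ n (S : Fin n → Bool) → Any (λ P → ∀ x → P x ≡ S x) (allSubsets n)
allSubsets-complete zero    S = here λ ()
allSubsets-complete (suc n) S =
  Any.concatMap⁺ _ (Any.map extend (allSubsets-complete n (S ∘ suc)))
  where
  extend : ∀ {P} → (∀ x → P x ≡ S (suc x)) →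
    Any (λ Q → ∀ x → Q x ≡ S x) ((false ∷ᶠ P) ∷ (true ∷ᶠ P) ∷ [])
  extend eq with S zero in eq₀
  ... | false = here λ { zero → ≡.sym eq₀ ; (suc x) → eq x }
  ... | true  = there (here λ { zero → ≡.sym eq₀ ; (suc x) → eq x })

module _ (A : Structure) where

  private
    σ-ext : ∀ {j} {σ : Fin j → Fin (size A) → Bool} {P Q} → (∀ a → Q a ≡ P a) →
      ∀ Z a → (Q ∷ᶠ σ) Z a ≡ (P ∷ᶠ σ) Z a
    σ-ext eq zero    = eq
    σ-ext eq (suc Z) = λ _ → refl

  -- Negation exchanges the two directions, so both are proved by one induction.
  eval-sound : ∀ {i j} (φ : Formula i j) {ρ σ} → eval A φ ρ σ ≡ true → Sat A φ ρ σ
  eval-complete : ∀ {i j} (φ : Formula i j) {ρ σ} → Sat A φ ρ σ → eval A φ ρ σ ≡ true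

  eval-sound (R x y) h = h
  eval-sound (Eq x y) h = ==-true h
  eval-sound (Mem x Z) h = h
  eval-sound (Not φ) h s = true≢false (eval-complete φ s) (not-true h)
  eval-sound (And φ ψ) h with ∧-true _ h
  ... | h₁ , h₂ = eval-sound φ h₁ , eval-sound ψ h₂
  eval-sound (Or φ ψ) h with ∨-true _ h
  ... | inj₁ h₁ = inj₁ (eval-sound φ h₁)
  ... | inj₂ h₂ = inj₂ (eval-sound ψ h₂)
  eval-sound (Ex φ) h with find (any-true _ (allFin _) h)
  ... | a , _ , h′ = a , eval-sound φ h′
  eval-sound (All φ) h a = eval-sound φ (All.lookup (all-true _ (allFin _) h) (∈-allFin a))
  eval-sound (ExS φ) h with find (any-true _ (allSubsets _) h)
  ... | P , _ , h′ = P , eval-sound φ h′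
  eval-sound (AllS φ) {ρ} {σ} h P with find (allSubsets-complete _ P)
  ... | Q , Q∈ , eq = Sat-cong A φ (λ _ → refl) (σ-ext (λ a → ≡.sym (eq a)))
    (eval-sound φ (All.lookup (all-true _ (allSubsets _) h) Q∈))

  eval-complete (R x y) s = s
  eval-complete (Eq x y) s = ==-intro s
  eval-complete (Mem x Z) s = s
  eval-complete (Not φ) {ρ} {σ} s with eval A φ ρ σ in eq
  ... | true  = contradiction (eval-sound φ eq) s
  ... | false = refl
  eval-complete (And φ ψ) (s , t) = ∧-intro (eval-complete φ s) (eval-complete ψ t)
  eval-complete (Or φ ψ) (inj₁ s) = ∨-introˡ _ (eval-complete φ s)
  eval-complete (Or φ ψ) (inj₂ s) = ∨-introʳ _ (eval-complete ψ s)
  eval-complete (Ex φ) (a , s) = any-intro _ (allFin _) (lose (∈-allFin a) (eval-complete φ s))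
  eval-complete (All φ) s = all-intro _ (allFin _) (All.universal (λ a → eval-complete φ (s a)) _)
  eval-complete (ExS φ) (P , s) = any-intro _ (allSubsets _) (Any.map
    (λ eq → eval-complete φ (Sat-cong A φ (λ _ → refl) (σ-ext eq) s))
    (allSubsets-complete _ P))
  eval-complete (AllS φ) s = all-intro _ (allSubsets _) (All.universal (λ P → eval-complete φ (s P)) _)

-- The incidence structure of a graph

lookup-injective : ∀ {A : Set} {xs : List A} → Unique xs →
  ∀ {i j} → lookup xs i ≡ lookup xs j → i ≡ j
lookup-injective (x∉ ∷ u) {zero}  {zero}  eq = refl
lookup-injective (x∉ ∷ u) {zero}  {suc j} eq = contradiction eq (All.lookup x∉ (∈-lookup j))
lookup-injective (x∉ ∷ u) {suc i} {zero}  eq = contradiction (≡.sym eq) (All.lookup x∉ (∈-lookup i))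
lookup-injective (x∉ ∷ u) {suc i} {suc j} eq = cong suc (lookup-injective u eq)

module Incidence (G : Graph) where

  V E X : Set
  V = Fin (n G)
  E = Fin (length (edges G))
  X = Fin (size ⌈ G ⌉)

  vtx : V → X
  vtx v = v ↑ˡ length (edges G)

  edg : E → X
  edg e = n G ↑ʳ e

  data View : X → Set where
    vertex : ∀ v → View (vtx v)
    edge   : ∀ e → View (edg e)

  view : ∀ x → View x
  view x with splitAt (n G) x | join-splitAt (n G) (length (edges G)) x
  ... | inj₁ v | refl = vertex v
  ... | inj₂ e | refl = edge e

  src tgt : E → V
  src e = proj₁ (lookup (edges G) e)
  tgt e = proj₂ (lookup (edges G) e)

  private
    keep : V × V → Bool
    keep e = (toℕ (proj₁ e) <ᵇ toℕ (proj₂ e)) ∧ adj G (proj₁ e) (proj₂ e)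

    row : V → List (V × V)
    row i = filterᵇ keep (map (i ,_) (allFin (n G)))

    ∈-row : ∀ {i p} → p ∈ row i → proj₁ p ≡ i × keep p ≡ true
    ∈-row {i} p∈ with ∈-filter⁻ (T? ∘ keep) {xs = map (i ,_) (allFin _)} p∈
    ... | p∈′ , kp with ∈-map⁻ (i ,_) p∈′
    ... | _ , _ , refl = refl , from-T kp

    keep-ends : ∀ e → keep (lookup (edges G) e) ≡ true
    keep-ends e with find (∈-concatMap⁻ row {xs = allFin (n G)} (∈-lookup e))
    ... | _ , _ , p∈ = proj₂ (∈-row p∈)

    edges-unique : Unique (edges G)
    edges-unique = Unique.concat⁺
      (All.map⁺ (All.universal (λ i → Unique.filter⁺ (T? ∘ keep)
        (Unique.map⁺ (cong proj₂) (Unique.allFin⁺ _))) (allFin (n G))))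
      (AllPairs.map⁺ (AllPairs.map
        (λ i≢j {_} (p∈i , p∈j) → i≢j (trans (≡.sym (proj₁ (∈-row p∈i))) (proj₁ (∈-row p∈j))))
        (Unique.allFin⁺ (n G))))

    ordered-edge : ∀ {u v} → toℕ u < toℕ v → adj G u v ≡ true →
      ∃[ e ] lookup (edges G) e ≡ (u , v)
    ordered-edge {u} {v} u<v uv = Any.index uv∈ , ≡.sym (Any.lookup-index uv∈)
      where
      uv∈ : (u , v) ∈ edges G
      uv∈ = ∈-concatMap⁺ row (lose (∈-allFin u)
        (∈-filter⁺ (T? ∘ keep) (∈-map⁺ (u ,_) (∈-allFin v))
          (to-T (∧-intro (from-T (<⇒<ᵇ u<v)) uv))))

  src<tgt : ∀ e → toℕ (src e) < toℕ (tgt e)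
  src<tgt e = <ᵇ⇒< _ _ (to-T (proj₁ (∧-true _ (keep-ends e))))

  adj-ends : ∀ e → adj G (src e) (tgt e) ≡ true
  adj-ends e = proj₂ (∧-true (toℕ (src e) <ᵇ toℕ (tgt e)) (keep-ends e))

  Joins : E → V → V → Set
  Joins e u v = (src e ≡ u × tgt e ≡ v) ⊎ (src e ≡ v × tgt e ≡ u)

  joins-ends : ∀ e → Joins e (src e) (tgt e)
  joins-ends e = inj₁ (refl , refl)

  joins-sym : ∀ {e u v} → Joins e u v → Joins e v u
  joins-sym (inj₁ p) = inj₂ p
  joins-sym (inj₂ p) = inj₁ p

  joins-adj : ∀ {e u v} → Joins e u v → adj G u v ≡ true
  joins-adj {e} (inj₁ (refl , refl)) = adj-ends e
  joins-adj {e} (inj₂ (refl , refl)) = trans (sym G _ _) (adj-ends e)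

  -- Stored pairs are increasing, which excludes opposite orientations, and the edge list has no
  -- repetitions.
  joins-unique : ∀ {e f u v} → Joins e u v → Joins f u v → e ≡ f
  joins-unique {e} {f} (inj₁ (a , b)) (inj₁ (c , d)) =
    lookup-injective edges-unique (cong₂ _,_ (trans a (≡.sym c)) (trans b (≡.sym d)))
  joins-unique {e} {f} (inj₂ (a , b)) (inj₂ (c , d)) =
    lookup-injective edges-unique (cong₂ _,_ (trans a (≡.sym c)) (trans b (≡.sym d)))
  joins-unique {e} {f} (inj₁ (refl , refl)) (inj₂ (c , d)) =
    contradiction (src<tgt f) (<-asym (≡.subst₂ (λ x y → toℕ x < toℕ y) (≡.sym d) (≡.sym c) (src<tgt e)))
  joins-unique {e} {f} (inj₂ (refl , refl)) (inj₁ (c , d)) =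
    contradiction (src<tgt f) (<-asym (≡.subst₂ (λ x y → toℕ x < toℕ y) (≡.sym d) (≡.sym c) (src<tgt e)))

  abstract
    edge-between : ∀ u v → adj G u v ≡ true → ∃[ e ] Joins e u v
    edge-between u v uv with Fin.<-cmp u v
    ... | tri< u<v _ _ with ordered-edge u<v uv
    ...   | e , eq = e , inj₁ (cong proj₁ eq , cong proj₂ eq)
    edge-between u v uv | tri> _ _ v<u with ordered-edge v<u (trans (sym G v u) uv)
    ...   | e , eq = e , inj₂ (cong proj₁ eq , cong proj₂ eq)
    edge-between u .u uv | tri≈ _ refl _ = contradiction (irrefl G u) (true≢false uv)

  Incident : V → E → Set
  Incident v e = v ≡ src e ⊎ v ≡ tgt e

  rel-incident : ∀ {v e} → rel ⌈ G ⌉ (vtx v) (edg e) ≡ true → Incident v e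
  rel-incident {v} {e} h
    rewrite splitAt-↑ˡ (n G) v (length (edges G)) | splitAt-↑ʳ (n G) (length (edges G)) e
    with ∨-true (v == src e) h
  ... | inj₁ p = inj₁ (==-true p)
  ... | inj₂ p = inj₂ (==-true p)

  incident-rel : ∀ {v e} → Incident v e → rel ⌈ G ⌉ (vtx v) (edg e) ≡ true
  incident-rel {v} {e} h
    rewrite splitAt-↑ˡ (n G) v (length (edges G)) | splitAt-↑ʳ (n G) (length (edges G)) e
    with h
  ... | inj₁ p = ∨-introˡ _ (==-intro p)
  ... | inj₂ p = ∨-introʳ (v == src e) (==-intro p)

  rel-vertex : ∀ x v → rel ⌈ G ⌉ x (vtx v) ≡ false
  rel-vertex x v rewrite splitAt-↑ˡ (n G) v (length (edges G)) with splitAt (n G) x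
  ... | inj₁ _ = refl
  ... | inj₂ _ = refl

  rel-edge : ∀ e y → rel ⌈ G ⌉ (edg e) y ≡ false
  rel-edge e y rewrite splitAt-↑ʳ (n G) (length (edges G)) e = refl

  joins-incident : ∀ {e u v} → u ≢ v → Incident u e → Incident v e → Joins e u v
  joins-incident u≢v (inj₁ refl) (inj₁ refl) = contradiction refl u≢v
  joins-incident u≢v (inj₁ refl) (inj₂ refl) = inj₁ (refl , refl)
  joins-incident u≢v (inj₂ refl) (inj₁ refl) = inj₂ (refl , refl)
  joins-incident u≢v (inj₂ refl) (inj₂ refl) = contradiction refl u≢v

  incident-joinsˡ : ∀ {e u v} → Joins e u v → Incident u e
  incident-joinsˡ (inj₁ (refl , _)) = inj₁ refl
  incident-joinsˡ (inj₂ (_ , refl)) = inj₂ refl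

  incident-joinsʳ : ∀ {e u v} → Joins e u v → Incident v e
  incident-joinsʳ {e} j = incident-joinsˡ {e} (joins-sym {e} j)

  private
    elementIf : ∀ u v b → adj G u v ≡ b → X
    elementIf u v true  uv = edg (proj₁ (edge-between u v uv))
    -- Arbitrary default: values at non-adjacent pairs never enter the swap argument.
    elementIf u v false _  = vtx u

    elementIf-joins : ∀ {e u v} b uv → Joins e u v → elementIf u v b uv ≡ edg e
    elementIf-joins {e} {u} {v} true uv j =
      cong edg (joins-unique (proj₂ (edge-between u v uv)) j)
    elementIf-joins {e} false uv j = contradiction uv (true≢false (joins-adj {e} j))

  element : V → V → X
  element u v = elementIf u v (adj G u v) refl

  element-joins : ∀ {e u v} → Joins e u v → element u v ≡ edg e
  element-joins = elementIf-joins _ refl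

-- Counting and ranking

bit : Bool → ℕ
bit b = if b then 1 else 0

count : ∀ {n} → (Fin n → Bool) → ℕ
count {zero}  S = 0
count {suc n} S = bit (S zero) + count (S ∘ suc)

card-count : ∀ {n} (S : Fin n → Bool) → card S ≡ count S
card-count {n} S = go n id
  where
  go : ∀ m (f : Fin m → Fin n) → length (filterᵇ S (tabulate f)) ≡ count (S ∘ f)
  go zero    f = refl
  go (suc m) f with S (f zero)
  ... | true  = cong suc (go m (f ∘ suc))
  ... | false = go m (f ∘ suc)

count-cong : ∀ {n} {S S′ : Fin n → Bool} → (∀ v → S v ≡ S′ v) → count S ≡ count S′
count-cong {zero}  eq = refl
count-cong {suc n} eq = cong₂ _+_ (cong bit (eq zero)) (count-cong (eq ∘ suc))

count-mono : ∀ {n} {S S′ : Fin n → Bool} → (∀ v → S v ≡ true → S′ v ≡ true) → count S ≤ count S′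
count-mono {zero}  h = z≤n
count-mono {suc n} {S} {S′} h = +-mono-≤ bit-mono (count-mono (h ∘ suc))
  where
  bit-mono : bit (S zero) ≤ bit (S′ zero)
  bit-mono with S zero in eq
  ... | false = z≤n
  ... | true rewrite h zero eq = ≤-refl

count-+ : ∀ a {b} (S : Fin (a + b) → Bool) → count S ≡ count (S ∘ (_↑ˡ b)) + count (S ∘ (a ↑ʳ_))
count-+ zero    S = refl
count-+ (suc a) S = trans (cong (bit (S zero) +_) (count-+ a (S ∘ suc))) (≡.sym (+-assoc (bit (S zero)) _ _))

count-const : ∀ n b → count {n} (λ _ → b) ≡ (if b then n else 0)
count-const zero    true  = refl
count-const zero    false = refl
count-const (suc n) true  = cong suc (count-const n true)
count-const (suc n) false = count-const n false

-- Together with `unrank` this numbers the members of `S` from 0. Outer vertices, half-graph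
-- thresholds, digit positions and codes are all indexed in this way.
rank : ∀ {n} → (Fin n → Bool) → Fin n → ℕ
rank S zero    = 0
rank S (suc v) = bit (S zero) + rank (S ∘ suc) v

rank-< : ∀ {n} (S : Fin n → Bool) {v} → S v ≡ true → rank S v < count S
rank-< S {zero}  Sv rewrite Sv = s≤s z≤n
rank-< S {suc v} Sv = +-monoʳ-< (bit (S zero)) (rank-< (S ∘ suc) Sv)

rank-injective : ∀ {n} (S : Fin n → Bool) {u v} → S u ≡ true → S v ≡ true → rank S u ≡ rank S v → u ≡ v
rank-injective S {zero}  {zero}  Su Sv eq = refl
rank-injective S {zero}  {suc v} Su Sv eq rewrite Su with () ← eq
rank-injective S {suc u} {zero}  Su Sv eq rewrite Sv with () ← eq
rank-injective S {suc u} {suc v} Su Sv eq =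
  cong suc (rank-injective (S ∘ suc) Su Sv (+-cancelˡ-≡ (bit (S zero)) _ _ eq))

unrank : ∀ {n} (S : Fin n → Bool) {r} → r < count S → ∃[ v ] S v ≡ true × rank S v ≡ r
unrank {suc n} S {r} r< with S zero in eq
unrank {suc n} S {zero}  r< | true = zero , eq , refl
unrank {suc n} S {suc r} r< | true with unrank (S ∘ suc) (s≤s⁻¹ r<)
... | v , Sv , rv = suc v , Sv , trans (cong (λ b → bit b + rank (S ∘ suc) v) eq) (cong suc rv)
unrank {suc n} S {r} r< | false with unrank (S ∘ suc) r<
... | v , Sv , rv = suc v , Sv , trans (cong (λ b → bit b + rank (S ∘ suc) v) eq) rv

two-members : ∀ {n} (S : Fin n → Bool) →
  count S ≤ 1 ⊎ ∃[ u ] ∃[ v ] toℕ u < toℕ v × S u ≡ true × S v ≡ true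
two-members S with count S ≤? 1
... | yes p = inj₁ p
... | no ¬p with unrank S (≤-trans (s≤s z≤n) (≰⇒> ¬p)) | unrank S (≰⇒> ¬p)
... | u , Su , ru | v , Sv , rv with Fin.<-cmp u v
... | tri< u<v _ _ = inj₂ (u , v , u<v , Su , Sv)
... | tri> _ _ v<u = inj₂ (v , u , v<u , Sv , Su)
... | tri≈ _ refl _ with () ← trans (≡.sym ru) rv

-- Unions of parts are measured on the list, where splitting is plain arithmetic; `count-parts`
-- carries the results back to vertex sets.
weight : (ℕ → Bool) → List ℕ → ℕ
weight f []      = 0
weight f (a ∷ m) = (if f 0 then a else 0) + weight (f ∘ suc) m

partOf-↑ˡ : ∀ a m (u : Fin a) → partOf (a ∷ m) (u ↑ˡ sum m) ≡ 0
partOf-↑ˡ a m u rewrite splitAt-↑ˡ a u (sum m) = refl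

partOf-↑ʳ : ∀ a m (u : Fin (sum m)) → partOf (a ∷ m) (a ↑ʳ u) ≡ suc (partOf m u)
partOf-↑ʳ a m u rewrite splitAt-↑ʳ a (sum m) u = refl

count-parts : ∀ f m → count (f ∘ partOf m) ≡ weight f m
count-parts f []      = refl
count-parts f (a ∷ m) = trans (count-+ a (f ∘ partOf (a ∷ m))) (cong₂ _+_
  (trans (count-cong (cong f ∘ partOf-↑ˡ a m)) (count-const a (f 0)))
  (trans (count-cong (cong f ∘ partOf-↑ʳ a m)) (count-parts (f ∘ suc) m)))

weight-false : ∀ m → weight (λ _ → false) m ≡ 0
weight-false []      = refl
weight-false (a ∷ m) = weight-false m

weight-true : ∀ m → weight (λ _ → true) m ≡ sum m
weight-true []      = refl
weight-true (a ∷ m) = cong (a +_) (weight-true m)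

weight-not : ∀ f m → weight f m + weight (not ∘ f) m ≡ sum m
weight-not f []      = refl
weight-not f (a ∷ m) = trans (interchange (if f 0 then a else 0) _ _ _)
  (cong₂ _+_ (head (f 0)) (weight-not (f ∘ suc) m))
  where
  head : ∀ b → (if b then a else 0) + (if not b then a else 0) ≡ a
  head true  = +-identityʳ a
  head false = refl

weight-part-≤ : ∀ i m → weight (_≡ᵇ i) m ≤ maxPart m
weight-part-≤ i       []      = z≤n
weight-part-≤ zero    (a ∷ m) = subst (_≤ a ⊔ maxPart m)
  (≡.sym (trans (cong (a +_) (weight-false m)) (+-identityʳ a))) (m≤m⊔n a (maxPart m))
weight-part-≤ (suc i) (a ∷ m) = ≤-trans (weight-part-≤ i m) (m≤n⊔m a (maxPart m))

largest-part : ∀ m → ∃[ i ] weight (_≡ᵇ i) m ≡ maxPart m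
largest-part []      = 0 , refl
largest-part (a ∷ m) with ≤-total (maxPart m) a | largest-part m
... | inj₁ p | _      = 0 , trans (cong (a +_) (weight-false m))
  (trans (+-identityʳ a) (≡.sym (m≥n⇒m⊔n≡m p)))
... | inj₂ p | i , eq = suc i , trans eq (≡.sym (m≤n⇒m⊔n≡n p))

weight-trichotomy : ∀ k m → weight (_<ᵇ k) m + (weight (_≡ᵇ k) m + weight (k <ᵇ_) m) ≡ sum m
weight-trichotomy k [] = refl
weight-trichotomy zero (a ∷ m)
  rewrite weight-false m | weight-true m | +-identityʳ a = refl
weight-trichotomy (suc k) (a ∷ m) =
  trans (+-assoc a _ _) (cong (a +_) (weight-trichotomy k m))

-- The witness is the part in which the running total first reaches `h`. The second bound is
-- additive to avoid truncated subtraction.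
median-part : ∀ m h → h ≤ sum m →
  ∃[ k ] weight (_<ᵇ k) m ≤ h × weight (k <ᵇ_) m + h ≤ sum m
median-part []      h h≤ = 0 , z≤n , h≤
median-part (a ∷ m) h h≤ with h ≤? a
... | yes h≤a = 0 , ≤-trans (≤-reflexive (weight-false m)) z≤n ,
  subst (_≤ a + sum m) (+-comm h _)
    (+-mono-≤ h≤a (≤-reflexive (weight-true m)))
... | no h≰a with median-part m (h ∸ a)
    (≤-trans (∸-monoˡ-≤ a h≤) (≤-reflexive (m+n∸m≡n a (sum m))))
...   | k , p , q = suc k ,
  ≤-trans (+-monoʳ-≤ a p) (≤-reflexive a+h∸a) ,
  ≤-trans (≤-reflexive (trans (cong (weight (k <ᵇ_) m +_) (≡.sym a+h∸a))
    (x∙yz≈y∙xz (weight (k <ᵇ_) m) a (h ∸ a)))) (+-monoʳ-≤ a q)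
  where
  a+h∸a : a + (h ∸ a) ≡ h
  a+h∸a = m+[n∸m]≡n (<⇒≤ (≰⇒> h≰a))

-- Connected components

same-part : ∀ m {u v} → adj (K m) u v ≡ false → partOf m u ≡ partOf m v
same-part m eq = ≡ᵇ-true (not-injective eq)

same-part-not-adj : ∀ m {u v} → partOf m u ≡ partOf m v → adj (K m) u v ≡ false
same-part-not-adj m eq = cong not (≡ᵇ-intro eq)

other-part-adj : ∀ m {u v} → partOf m u ≢ partOf m v → adj (K m) u v ≡ true
other-part-adj m {u} {v} ≢ with adj (K m) u v in eq
... | true  = refl
... | false = contradiction (same-part m eq) ≢

adj-other-part : ∀ m {u v} → adj (K m) u v ≡ true → partOf m u ≢ partOf m v
adj-other-part m {u} {v} uv eq = true≢false uv (same-part-not-adj m {u} {v} eq)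

module _ (G : Graph) (S : Fin (n G) → Bool) where

  reach-start : ∀ {u} → S u ≡ false → reachIter G S 0 u u ≡ true
  reach-start {u} Su = ∧-intro (not-intro Su) (==-intro {u = u} refl)

  reach-step : ∀ {t u w v} → reachIter G S t u w ≡ true → adj G w v ≡ true → S v ≡ false →
    reachIter G S (suc t) u v ≡ true
  reach-step {t} {u} {w} {v} uw wv Sv = ∨-introʳ (reachIter G S t u v)
    (any-intro _ (allFin (n G)) (lose (∈-allFin w) (∧-intro uw (∧-intro wv (not-intro Sv)))))

  reach-weaken : ∀ {t t′ u v} → t ≤′ t′ → reachIter G S t u v ≡ true → reachIter G S t′ u v ≡ true
  reach-weaken (≤′-reflexive refl) uv = uv
  reach-weaken (≤′-step t≤)        uv = ∨-introˡ _ (reach-weaken t≤ uv)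

  reach-target : ∀ t {u v} → reachIter G S t u v ≡ true → S v ≡ false
  reach-target zero uv with ∧-true _ uv
  ... | Su , u=v = trans (cong S (≡.sym (==-true u=v))) (not-true Su)
  reach-target (suc t) {u} {v} uv with ∨-true (reachIter G S t u v) uv
  ... | inj₁ h = reach-target t h
  ... | inj₂ h with find (any-true _ (allFin (n G)) h)
  ...   | w , _ , h′ = not-true (proj₂ (∧-true (adj G w v) (proj₂ (∧-true (reachIter G S t u w) h′))))

  reach-edgeless : (∀ w v → S w ≡ false → S v ≡ false → adj G w v ≡ false) →
    ∀ t {u v} → reachIter G S t u v ≡ true → u ≡ v
  reach-edgeless no-edge zero uv = ==-true (proj₂ (∧-true _ uv))
  reach-edgeless no-edge (suc t) {u} {v} uv with ∨-true (reachIter G S t u v) uv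
  ... | inj₁ h = reach-edgeless no-edge t h
  ... | inj₂ h with find (any-true _ (allFin (n G)) h)
  ...   | w , _ , h′ with ∧-true (reachIter G S t u w) h′
  ...     | uw , h″ with ∧-true (adj G w v) h″
  ...       | wv , Sv = contradiction
    (no-edge w v (reach-target t uw) (not-true Sv)) (true≢false wv)

  -- This is by definition the predicate that `components` counts, so `card-count` applies to it
  -- directly.
  leastOfComponent : Fin (n G) → Bool
  leastOfComponent v = not (S v) ∧
    all (λ u → not ((toℕ u <ᵇ toℕ v) ∧ connectedIn G S u v)) (allFin (n G))

  least-outside : ∀ {v} → leastOfComponent v ≡ true → S v ≡ false
  least-outside h = not-true (proj₁ (∧-true _ h))

  least-not-connected : ∀ {u v} → leastOfComponent v ≡ true → toℕ u < toℕ v →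
    connectedIn G S u v ≡ false
  least-not-connected {u} {v} h u<v with connectedIn G S u v in eq
  ... | false = refl
  ... | true  = contradiction
    (not-true (All.lookup (all-true _ (allFin (n G)) (proj₂ (∧-true (not (S v)) h))) (∈-allFin u)))
    (true≢false (∧-intro (from-T (<⇒<ᵇ u<v)) eq))

  least-intro : ∀ {v} → S v ≡ false → (∀ u → toℕ u < toℕ v → ¬ connectedIn G S u v ≡ true) →
    leastOfComponent v ≡ true
  least-intro {v} Sv h = ∧-intro (not-intro Sv)
    (all-intro _ (allFin (n G)) (All.universal (λ u → not-intro (no-conn u)) _))
    where
    no-conn : ∀ u → (toℕ u <ᵇ toℕ v) ∧ connectedIn G S u v ≡ false
    no-conn u with (toℕ u <ᵇ toℕ v) ∧ connectedIn G S u v in eq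
    ... | false = refl
    ... | true with ∧-true (toℕ u <ᵇ toℕ v) eq
    ...   | u<v , c = contradiction c (h u (<ᵇ⇒< (toℕ u) (toℕ v) (to-T u<v)))

-- A survivor `w` outside the part of `u` is adjacent to `u`. If `w` is adjacent to `v`, it links
-- the two; if not, it shares the part of `v`, and then `u` and `v` are adjacent.
disconnected-one-part : ∀ m S {u v} →
  toℕ u < toℕ v → leastOfComponent (K m) S u ≡ true → leastOfComponent (K m) S v ≡ true →
  ∀ w → S w ≡ false → partOf m w ≡ partOf m u
disconnected-one-part m S {u} {v} u<v lu lv w Sw with partOf m w ≟ partOf m u
... | yes p = p
... | no ¬p = contradiction (least-not-connected (K m) S lv u<v) (true≢false connected)
  where
  Su : S u ≡ false
  Su = least-outside (K m) S lu
  Sv : S v ≡ false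
  Sv = least-outside (K m) S lv
  -- `connectedIn` iterates once per vertex; two distinct vertices already allow paths of length
  -- two.
  2≤n : 2 ≤ sum m
  2≤n = ≤-trans (s≤s (≤-trans (s≤s z≤n) u<v)) (toℕ<n v)
  uw : adj (K m) u w ≡ true
  uw = other-part-adj m (¬p ∘ ≡.sym)
  connected : connectedIn (K m) S u v ≡ true
  connected with adj (K m) w v in wv
  ... | true  = reach-weaken (K m) S (≤⇒≤′ 2≤n)
    (reach-step (K m) S {1} {u} {w} (reach-step (K m) S {0} {u} {u} (reach-start (K m) S Su) uw Sw) wv Sv)
  ... | false = reach-weaken (K m) S (≤⇒≤′ (≤-trans (s≤s z≤n) 2≤n))
    (reach-step (K m) S {0} {u} {u} (reach-start (K m) S Su)
      (other-part-adj m (λ eq → ¬p (trans (same-part m wv) (≡.sym eq)))) Sv)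

weight-not-≡ : ∀ f m → weight (not ∘ f) m ≡ sum m ∸ weight f m
weight-not-≡ f m = ≡.sym (trans (cong (_∸ weight f m) (≡.sym (weight-not f m))) (m+n∸m≡n (weight f m) _))

exponent-mono : ∀ s {a b} → a ≤ b → 2 ^ (s * (a + 1)) ≤ 2 ^ (s * (b + 1))
exponent-mono s a≤b = ^-monoʳ-≤ 2 (*-monoʳ-≤ s (+-monoˡ-≤ 1 a≤b))

bounded⇒SEP : ∀ s m → maxPart m ≤ 2 ^ (s * (sum m ∸ maxPart m + 1)) →
  SEP (λ k → 2 ^ (s * (k + 1))) (K m)
bounded⇒SEP s m M≤ k S card≤
  with two-members (leastOfComponent (K m) S)
-- At most one component is within the bound because a power of two is positive.
... | inj₁ c≤1 = ≤-trans (≤-reflexive (card-count (leastOfComponent (K m) S)))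
  (≤-trans c≤1 (m^n>0 2 (s * (k + 1))))
... | inj₂ (u , v , u<v , lu , lv) = begin
  components (K m) S                    ≡⟨ card-count (leastOfComponent (K m) S) ⟩
  count (leastOfComponent (K m) S)      ≤⟨ count-mono (λ w lw → ≡ᵇ-intro (one-part w (least-outside (K m) S lw))) ⟩
  count ((_≡ᵇ i) ∘ partOf m)            ≡⟨ count-parts (_≡ᵇ i) m ⟩
  weight (_≡ᵇ i) m                      ≤⟨ weight-part-≤ i m ⟩
  maxPart m                             ≤⟨ M≤ ⟩
  2 ^ (s * (sum m ∸ maxPart m + 1))     ≤⟨ exponent-mono s N∸M≤k ⟩
  2 ^ (s * (k + 1))                     ∎
  where
  open ≤-Reasoning
  i = partOf m u
  one-part = disconnected-one-part m S u<v lu lv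
  outside : ∀ w → not (partOf m w ≡ᵇ i) ≡ true → S w ≡ true
  outside w h with S w in eq
  ... | true  = refl
  ... | false = contradiction (not-true h) (true≢false (≡ᵇ-intro (one-part w eq)))
  -- `S` contains everything outside part `i`, and part `i` has at most `M` vertices.
  N∸M≤k : sum m ∸ maxPart m ≤ k
  N∸M≤k = begin
    sum m ∸ maxPart m                     ≤⟨ ∸-monoʳ-≤ (sum m) (weight-part-≤ i m) ⟩
    sum m ∸ weight (_≡ᵇ i) m              ≡⟨ weight-not-≡ (_≡ᵇ i) m ⟨
    weight (not ∘ (_≡ᵇ i)) m              ≡⟨ count-parts (not ∘ (_≡ᵇ i)) m ⟨
    count (not ∘ (_≡ᵇ i) ∘ partOf m)      ≤⟨ count-mono outside ⟩
    count S                               ≡⟨ card-count S ⟨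
    card S                                ≤⟨ card≤ ⟩
    k                                     ∎

SEP⇒bounded : ∀ f m → SEP f (K m) → maxPart m ≤ f (sum m ∸ maxPart m)
SEP⇒bounded f m sep with largest-part m
... | i , eq = begin
  maxPart m                          ≡⟨ eq ⟨
  weight (_≡ᵇ i) m                   ≡⟨ count-parts (_≡ᵇ i) m ⟨
  count ((_≡ᵇ i) ∘ partOf m)         ≤⟨ count-mono isolated ⟩
  count (leastOfComponent (K m) S)   ≡⟨ card-count (leastOfComponent (K m) S) ⟨
  components (K m) S                 ≤⟨ sep (sum m ∸ maxPart m) S (≤-reflexive card≡) ⟩
  f (sum m ∸ maxPart m)              ∎
  where
  open ≤-Reasoning
  S : Fin (sum m) → Bool
  S = not ∘ (_≡ᵇ i) ∘ partOf m
  in-part : ∀ {v} → S v ≡ false → partOf m v ≡ i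
  in-part h = ≡ᵇ-true (not-injective h)
  isolated : ∀ v → (partOf m v ≡ᵇ i) ≡ true → leastOfComponent (K m) S v ≡ true
  isolated v h = least-intro (K m) S (cong not h) λ u u<v c →
    <⇒≢ u<v (cong toℕ (reach-edgeless (K m) S
      (λ w x Sw Sx → same-part-not-adj m (trans (in-part Sw) (≡.sym (in-part Sx)))) (sum m) c))
  card≡ : card S ≡ sum m ∸ maxPart m
  card≡ = trans (card-count S) (trans (count-parts (not ∘ (_≡ᵇ i)) m)
    (trans (weight-not-≡ (_≡ᵇ i) m) (cong (sum m ∸_) eq)))

SEP⇔Bounded : ∀ C → SEP-class C ⇔ Bounded C
SEP⇔Bounded C = mk⇔
  (λ (s , h) → s , λ m Cm → SEP⇒bounded (λ k → 2 ^ (s * (k + 1))) m (h m Cm))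
  (λ (s , h) → s , λ m Cm → bounded⇒SEP s m (h m Cm))

-- Automorphisms exchanging vertices of the same colour

module _ {n : ℕ} (a b : Fin n) where

  swap : Fin n → Fin n
  swap v with v Fin.≟ a | v Fin.≟ b
  ... | yes _ | _     = b
  ... | no _  | yes _ = a
  ... | no _  | no _  = v

  swap-left : swap a ≡ b
  swap-left with a Fin.≟ a
  ... | yes _ = refl
  ... | no ¬p = contradiction refl ¬p

  swap-right : swap b ≡ a
  swap-right with b Fin.≟ a | b Fin.≟ b
  ... | yes p | _     = p
  ... | no _  | yes _ = refl
  ... | no _  | no ¬p = contradiction refl ¬p

  swap-other : ∀ {v} → v ≢ a → v ≢ b → swap v ≡ v
  swap-other {v} ≢a ≢b with v Fin.≟ a | v Fin.≟ b
  ... | yes p | _     = contradiction p ≢a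
  ... | no _  | yes p = contradiction p ≢b
  ... | no _  | no _  = refl

  swap-cases : ∀ v → v ≡ a ⊎ v ≡ b ⊎ (v ≢ a × v ≢ b)
  swap-cases v with v Fin.≟ a | v Fin.≟ b
  ... | yes p | _     = inj₁ p
  ... | no _  | yes p = inj₂ (inj₁ p)
  ... | no p  | no q  = inj₂ (inj₂ (p , q))

  swap-involutive : ∀ v → swap (swap v) ≡ v
  swap-involutive v with swap-cases v
  ... | inj₁ refl              = trans (cong swap swap-left) swap-right
  ... | inj₂ (inj₁ refl)       = trans (cong swap swap-right) swap-left
  ... | inj₂ (inj₂ (≢a , ≢b))  = trans (cong swap (swap-other ≢a ≢b)) (swap-other ≢a ≢b)

module GraphInvolution (G : Graph) (π : Fin (n G) → Fin (n G))
         (π-invol : (v : Fin (n G)) → π (π v) ≡ v)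
         (π-adj : (u v : Fin (n G)) → adj G (π u) (π v) ≡ adj G u v) where

  open Incidence G

  πᵉ : E → E
  πᵉ e = proj₁ (edge-between (π (src e)) (π (tgt e)) (trans (π-adj _ _) (adj-ends e)))

  πᵉ-ends : ∀ e → Joins (πᵉ e) (π (src e)) (π (tgt e))
  πᵉ-ends e = proj₂ (edge-between (π (src e)) (π (tgt e)) (trans (π-adj _ _) (adj-ends e)))

  πᵉ-joins : ∀ {e u v} → Joins e u v → Joins (πᵉ e) (π u) (π v)
  πᵉ-joins {e} (inj₁ (refl , refl)) = πᵉ-ends e
  πᵉ-joins {e} (inj₂ (refl , refl)) = joins-sym {πᵉ e} (πᵉ-ends e)

  πᵉ-invol : ∀ e → πᵉ (πᵉ e) ≡ e
  πᵉ-invol e = joins-unique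
    (subst₂ (Joins (πᵉ (πᵉ e))) (π-invol _) (π-invol _) (πᵉ-joins (πᵉ-ends e)))
    (joins-ends e)

  Π : X → X
  Π x = [ vtx ∘ π , edg ∘ πᵉ ]′ (splitAt (n G) x)

  Π-vtx : ∀ v → Π (vtx v) ≡ vtx (π v)
  Π-vtx v rewrite splitAt-↑ˡ (n G) v (length (edges G)) = refl

  Π-edg : ∀ e → Π (edg e) ≡ edg (πᵉ e)
  Π-edg e rewrite splitAt-↑ʳ (n G) (length (edges G)) e = refl

  Π-invol : ∀ x → Π (Π x) ≡ x
  Π-invol x with view x
  ... | vertex v = trans (cong Π (Π-vtx v)) (trans (Π-vtx (π v)) (cong vtx (π-invol v)))
  ... | edge e   = trans (cong Π (Π-edg e)) (trans (Π-edg (πᵉ e)) (cong edg (πᵉ-invol e)))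

  incident-π : ∀ {v e} → Incident v e → Incident (π v) (πᵉ e)
  incident-π {e = e} (inj₁ refl) = incident-joinsˡ (πᵉ-ends e)
  incident-π {e = e} (inj₂ refl) = incident-joinsʳ {πᵉ e} (πᵉ-ends e)

  rel-Π : ∀ x y → rel ⌈ G ⌉ (Π x) (Π y) ≡ rel ⌈ G ⌉ x y
  rel-Π x y with view x | view y
  ... | edge e   | _ = trans (cong (λ z → rel ⌈ G ⌉ z (Π y)) (Π-edg e))
    (trans (rel-edge (πᵉ e) (Π y)) (≡.sym (rel-edge e y)))
  ... | vertex u | vertex v = trans (cong (rel ⌈ G ⌉ (Π (vtx u))) (Π-vtx v))
    (trans (rel-vertex (Π (vtx u)) (π v)) (≡.sym (rel-vertex (vtx u) v)))
  ... | vertex v | edge e   = trans (cong₂ (rel ⌈ G ⌉) (Π-vtx v) (Π-edg e)) (bool-ext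
    (λ h → incident-rel (subst₂ Incident (π-invol v) (πᵉ-invol e)
      (incident-π {π v} {πᵉ e} (rel-incident h))))
    (λ h → incident-rel (incident-π {v} {e} (rel-incident h))))

-- Binary codes, colours and the pigeonhole bound

toBit : Bool → Fin 2
toBit false = zero
toBit true  = suc zero

toBit-injective : ∀ {a b} → toBit a ≡ toBit b → a ≡ b
toBit-injective {false} {false} eq = refl
toBit-injective {true}  {true}  eq = refl

encode : ∀ {l} → (Fin l → Bool) → Fin (2 ^ l)
encode β = funToFin (toBit ∘ β)

encode-injective : ∀ {l} {β γ : Fin l → Bool} → encode β ≡ encode γ → ∀ q → β q ≡ γ q
encode-injective {β = β} {γ} eq q = toBit-injective (trans (≡.sym (finToFun-funToFin (toBit ∘ β) q))
  (trans (cong (λ c → finToFun c q) eq) (finToFun-funToFin (toBit ∘ γ) q)))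

module Colouring (m : List ℕ) (i : ℕ) {k : ℕ} (P : Fin k → Fin (size ⌈ K m ⌉) → Bool) where

  open Incidence (K m)

  outer : V → Bool
  outer = not ∘ (_≡ᵇ i) ∘ partOf m

  -- These are the elements touching `a` that a swap inside part `i` can move; `a` itself accounts
  -- for the `+1` in the exponent.
  star : V → Fin (suc (count outer)) → X
  star a zero    = vtx a
  star a (suc r) = element a (proj₁ (unrank outer (toℕ<n r)))

  -- The position `p` does not depend on `a`, so equal colours of `a` and `b` compare their edges to
  -- the same `v`.
  star-outer : ∀ {v} → outer v ≡ true → ∃[ p ] ∀ a → star a p ≡ element a v
  star-outer {v} out = suc (fromℕ< r<) , λ a → cong (element a)
    (let w , out-w , rank-w = unrank outer (toℕ<n (fromℕ< r<)) in
      rank-injective outer out-w out (trans rank-w (toℕ-fromℕ< r<)))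
    where r< = rank-< outer out

  colour : V → Fin (k * suc (count outer)) → Bool
  colour a q = uncurry (λ j p → P j (star a p)) (remQuot (suc (count outer)) q)

  module _ {a b : V} (a∈ : partOf m a ≡ i) (b∈ : partOf m b ≡ i)
           (same : ∀ q → colour a q ≡ colour b q) where

    private
      same-star : ∀ j p → P j (star a p) ≡ P j (star b p)
      same-star j p = subst (λ (j , p) → P j (star a p) ≡ P j (star b p))
        (remQuot-combine j p) (same (combine j p))

      same-element : ∀ j {v} → outer v ≡ true → P j (element a v) ≡ P j (element b v)
      same-element j {v} out with star-outer out
      ... | p , eq = trans (cong (P j) (≡.sym (eq a))) (trans (same-star j p) (cong (P j) (eq b)))

      π : V → V
      π = swap a b

      π-part : ∀ v → partOf m (π v) ≡ partOf m v
      π-part v with swap-cases a b v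
      ... | inj₁ refl        = trans (cong (partOf m) (swap-left a b)) (trans b∈ (≡.sym a∈))
      ... | inj₂ (inj₁ refl) = trans (cong (partOf m) (swap-right a b)) (trans a∈ (≡.sym b∈))
      ... | inj₂ (inj₂ (≢a , ≢b)) = cong (partOf m) (swap-other a b ≢a ≢b)

      open GraphInvolution (K m) π (swap-involutive a b)
        (λ u v → cong₂ (λ x y → not (x ≡ᵇ y)) (π-part u) (π-part v))

      outer-neighbour : ∀ {e u v} → Joins e u v → partOf m u ≡ i → outer v ≡ true
      outer-neighbour {e} {u} {v} j u∈ = other-outer λ v∈ →
        adj-other-part m {u} {v} (joins-adj {e} j) (trans u∈ (≡.sym v∈))
        where
        other-outer : partOf m v ≢ i → outer v ≡ true
        other-outer ≢i with partOf m v ≡ᵇ i in eq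
        ... | false = refl
        ... | true  = contradiction (≡ᵇ-true eq) ≢i

      outer-fixed : ∀ {v} → outer v ≡ true → π v ≡ v
      outer-fixed {v} out = swap-other a b (λ { refl → absurd a∈ }) (λ { refl → absurd b∈ })
        where
        absurd : ¬ partOf m v ≡ i
        absurd eq = true≢false (≡ᵇ-intro eq) (not-true out)

      -- The neighbour `v` of `a` lies outside the part and stays fixed, so the edge moves to the
      -- one between `b` and `v`, which carries the same marks by equality of colours.
      colour-left : ∀ j e {v} → Joins e a v → P j (edg (πᵉ e)) ≡ P j (edg e)
      colour-left j e {v} av = trans (cong (P j) (≡.sym (element-joins
          (subst₂ (Joins (πᵉ e)) (swap-left a b) (outer-fixed out) (πᵉ-joins av)))))
        (trans (≡.sym (same-element j out)) (cong (P j) (element-joins av)))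
        where out = outer-neighbour {e} av a∈

      colour-right : ∀ j e {v} → Joins e b v → P j (edg (πᵉ e)) ≡ P j (edg e)
      colour-right j e {v} bv = trans (cong (P j) (≡.sym (element-joins
          (subst₂ (Joins (πᵉ e)) (swap-right a b) (outer-fixed out) (πᵉ-joins bv)))))
        (trans (same-element j out) (cong (P j) (element-joins bv)))
        where out = outer-neighbour {e} bv b∈

      colour-vertex : ∀ j v → P j (vtx (π v)) ≡ P j (vtx v)
      colour-vertex j v with swap-cases a b v
      ... | inj₁ refl = trans (cong (P j ∘ vtx) (swap-left a b)) (≡.sym (same-star j zero))
      ... | inj₂ (inj₁ refl) = trans (cong (P j ∘ vtx) (swap-right a b)) (same-star j zero)
      ... | inj₂ (inj₂ (≢a , ≢b)) = cong (P j ∘ vtx) (swap-other a b ≢a ≢b)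

      colour-edge : ∀ j e → P j (edg (πᵉ e)) ≡ P j (edg e)
      colour-edge j e = go (swap-cases a b (src e)) (swap-cases a b (tgt e))
        where
        Position : V → Set
        Position v = v ≡ a ⊎ v ≡ b ⊎ (v ≢ a × v ≢ b)
        go : Position (src e) → Position (tgt e) → P j (edg (πᵉ e)) ≡ P j (edg e)
        -- Once one end is `a` or `b`, the other is a neighbour, hence outside the part, and needs
        -- no case distinction.
        go (inj₁ eq)        _                = colour-left j e (inj₁ (eq , refl))
        go (inj₂ (inj₁ eq)) _                = colour-right j e (inj₁ (eq , refl))
        go (inj₂ (inj₂ _))  (inj₁ eq)        = colour-left j e (inj₂ (refl , eq))
        go (inj₂ (inj₂ _))  (inj₂ (inj₁ eq)) = colour-right j e (inj₂ (refl , eq))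
        go (inj₂ (inj₂ (p , q))) (inj₂ (inj₂ (p′ , q′))) = cong (P j ∘ edg) (joins-unique
          (subst₂ (Joins (πᵉ e)) (swap-other a b p q) (swap-other a b p′ q′) (πᵉ-ends e))
          (joins-ends e))

      colour-Π : ∀ j x → P j (Π x) ≡ P j x
      colour-Π j x with view x
      ... | vertex v = trans (cong (P j) (Π-vtx v)) (colour-vertex j v)
      ... | edge e   = trans (cong (P j) (Π-edg e)) (colour-edge j e)

    same-colour-symmetric : ∀ (φ : Formula 2 k) →
      eval ⌈ K m ⌉ φ (vtx a ∷ᶠ vtx b ∷ᶠ []ᶠ) P ≡ true →
      eval ⌈ K m ⌉ φ (vtx b ∷ᶠ vtx a ∷ᶠ []ᶠ) P ≡ true
    same-colour-symmetric φ h = eval-complete ⌈ K m ⌉ φ (Sat-involution Π-invol rel-Π φ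
      (λ { zero       → ≡.sym (trans (Π-vtx a) (cong vtx (swap-left a b)))
         ; (suc zero) → ≡.sym (trans (Π-vtx b) (cong vtx (swap-right a b))) })
      colour-Π (eval-sound ⌈ K m ⌉ φ h))

total-order⇒bounded : ∀ {k} (φ : Formula 2 k) m (P : Fin k → Fin (size ⌈ K m ⌉) → Bool) →
  IsTotalOrder _≡_ (λ a b → eval ⌈ K m ⌉ φ (a ∷ᶠ b ∷ᶠ []ᶠ) P ≡ true) →
  maxPart m ≤ 2 ^ (k * (sum m ∸ maxPart m + 1))
total-order⇒bounded {k} φ m P ord with largest-part m
... | i , largest = subst₂ (λ M l → M ≤ 2 ^ (k * l)) size-inner size-outer (≮⇒≥ too-many)
  where
  open Incidence (K m)
  open Colouring m i P
  open IsTotalOrder ord using (total; antisym)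
  inner : V → Bool
  inner = (_≡ᵇ i) ∘ partOf m
  size-inner : count inner ≡ maxPart m
  size-inner = trans (count-parts (_≡ᵇ i) m) largest
  size-outer : suc (count outer) ≡ sum m ∸ maxPart m + 1
  size-outer = trans (cong suc (trans (count-parts (not ∘ (_≡ᵇ i)) m)
    (trans (weight-not-≡ (_≡ᵇ i) m) (cong (sum m ∸_) largest)))) (+-comm 1 _)
  inner-vertex : Fin (count inner) → V
  inner-vertex r = proj₁ (unrank inner (toℕ<n r))
  in-part : ∀ r → partOf m (inner-vertex r) ≡ i
  in-part r = ≡ᵇ-true (proj₁ (proj₂ (unrank inner (toℕ<n r))))
  inner-rank : ∀ r → rank inner (inner-vertex r) ≡ toℕ r
  inner-rank r = proj₂ (proj₂ (unrank inner (toℕ<n r)))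
  too-many : ¬ 2 ^ (k * suc (count outer)) < count inner
  too-many lt with pigeonhole lt (encode ∘ colour ∘ inner-vertex)
  ... | r , r′ , r<r′ , eq = <⇒≢ r<r′
    (trans (≡.sym (inner-rank r)) (trans (cong (rank inner) a≡b) (inner-rank r′)))
    where
    a = inner-vertex r
    b = inner-vertex r′
    same = encode-injective eq
    a≡b : a ≡ b
    -- Whichever comparison holds, the swap supplies the opposite one.
    a≡b with total (vtx a) (vtx b)
    ... | inj₁ a≤b = ↑ˡ-injective _ _ _ (antisym a≤b
      (same-colour-symmetric (in-part r) (in-part r′) same φ a≤b))
    ... | inj₂ b≤a = ↑ˡ-injective _ _ _ (antisym
      (same-colour-symmetric (in-part r′) (in-part r) (≡.sym ∘ same) φ b≤a) b≤a)

-- Splitting the parts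

halving : ∀ N → ∃[ h ] h + h ≤ N × N ≤ suc (h + h)
halving zero          = 0 , z≤n , z≤n
halving (suc zero)    = 0 , z≤n , s≤s z≤n
halving (suc (suc N)) with halving N
... | h , p , q = suc h , s≤s (subst (_≤ suc N) (≡.sym (+-suc h h)) (s≤s p)) ,
  s≤s (s≤s (subst (N ≤_) (≡.sym (+-suc h h)) q))

n≤4^n : ∀ n → n ≤ 4 ^ n
n≤4^n zero    = z≤n
n≤4^n (suc n) = begin
  1 + n             ≤⟨ +-mono-≤ (m^n>0 4 n) (n≤4^n n) ⟩
  4 ^ n + 4 ^ n     ≤⟨ +-monoʳ-≤ (4 ^ n) (m≤m+n (4 ^ n) _) ⟩
  4 ^ suc n         ∎
  where open ≤-Reasoning

-- Origin of the 2 in `2 + s`: `3u ≤ 4u ≤ 4^(u+1)`, so two digits at each of the `u + 1` places are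
-- enough.
triple-≤ : ∀ s u {w} → w ≤ u + (u + u) → w ≤ 2 ^ ((2 + s) * suc u)
triple-≤ s u {w} w≤ = begin
  w                       ≤⟨ w≤ ⟩
  u + (u + u)             ≤⟨ +-monoʳ-≤ u (+-monoʳ-≤ u (m≤m+n u (u + 0))) ⟩
  4 * u                   ≤⟨ *-monoʳ-≤ 4 (n≤4^n u) ⟩
  (2 ^ 2) ^ suc u         ≡⟨ ^-*-assoc 2 2 (suc u) ⟩
  2 ^ (2 * suc u)         ≤⟨ ^-monoʳ-≤ 2 (*-monoˡ-≤ (suc u) (m≤m+n 2 s)) ⟩
  2 ^ ((2 + s) * suc u)   ∎
  where open ≤-Reasoning

-- The two sides can be ordered through the edges between them: the smaller one by a
-- half-graph, the larger one by binary codes.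
balanced-split : ∀ s m → maxPart m ≤ 2 ^ (s * (sum m ∸ maxPart m + 1)) →
  ∃[ f ] weight f m ≤ suc (weight (not ∘ f) m) ×
         weight (not ∘ f) m ≤ 2 ^ ((2 + s) * suc (weight f m))
balanced-split s m M≤ with halving (sum m)
... | h , 2h≤N , N≤2h+1 with median-part m h (≤-trans (m≤m+n h h) 2h≤N)
... | k , p≤h , q+h≤N = choose (p + q ≤? c) (≤-total p q)
  where
  open ≤-Reasoning
  p = weight (_<ᵇ k) m
  c = weight (_≡ᵇ k) m
  q = weight (k <ᵇ_) m
  Split = ∃[ f ] weight f m ≤ suc (weight (not ∘ f) m) ×
                 weight (not ∘ f) m ≤ 2 ^ ((2 + s) * suc (weight f m))
  total : p + (c + q) ≡ sum m
  total = weight-trichotomy k m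
  complement : ∀ f {w} → weight f m + w ≡ sum m → weight (not ∘ f) m ≡ w
  complement f eq = +-cancelˡ-≡ (weight f m) _ _ (trans (weight-not f m) (≡.sym eq))
  split-at : ∀ f {w} → weight f m + w ≡ sum m → weight f m ≤ suc w →
    w ≤ 2 ^ ((2 + s) * suc (weight f m)) → Split
  split-at f eq u≤ w≤ = f , subst (λ w → weight f m ≤ suc w) (≡.sym (complement f eq)) u≤ ,
    subst (_≤ 2 ^ ((2 + s) * suc (weight f m))) (≡.sym (complement f eq)) w≤
  p≤c+q : p ≤ c + q
  p≤c+q = +-cancelˡ-≤ p p (c + q) (begin
    p + p         ≤⟨ +-mono-≤ p≤h p≤h ⟩
    h + h         ≤⟨ 2h≤N ⟩
    sum m         ≡⟨ total ⟨
    p + (c + q)   ∎)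
  -- `h` is half of `N` rounded down; the extra 1 pays for odd `N`.
  q≤1+p+c : q ≤ suc (p + c)
  q≤1+p+c = begin
    q             ≤⟨ +-cancelʳ-≤ h q (suc h) (≤-trans q+h≤N N≤2h+1) ⟩
    suc h         ≤⟨ s≤s (+-cancelˡ-≤ q h (p + c) (begin
      q + h         ≤⟨ q+h≤N ⟩
      sum m         ≡⟨ total ⟨
      p + (c + q)   ≡⟨ +-assoc p c q ⟨
      (p + c) + q   ≡⟨ +-comm (p + c) q ⟩
      q + (p + c)   ∎)) ⟩
    suc (p + c)   ∎
  -- A smaller part has a larger complement, so the bound for a largest part passes to every part.
  c≤ : c ≤ 2 ^ ((2 + s) * suc (weight (not ∘ (_≡ᵇ k)) m))
  c≤ = begin
    c                                   ≤⟨ weight-part-≤ k m ⟩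
    maxPart m                           ≤⟨ M≤ ⟩
    2 ^ (s * (sum m ∸ maxPart m + 1))   ≤⟨ exponent-mono s (∸-monoʳ-≤ (sum m) (weight-part-≤ k m)) ⟩
    2 ^ (s * (sum m ∸ c + 1))           ≡⟨ cong (λ l → 2 ^ (s * l)) (trans (+-comm _ 1)
                                             (cong suc (≡.sym (weight-not-≡ (_≡ᵇ k) m)))) ⟩
    2 ^ (s * suc (weight (not ∘ (_≡ᵇ k)) m))
      ≤⟨ ^-monoʳ-≤ 2 (*-monoˡ-≤ (suc (weight (not ∘ (_≡ᵇ k)) m)) (m≤n+m s 2)) ⟩
    2 ^ ((2 + s) * suc (weight (not ∘ (_≡ᵇ k)) m))   ∎
  outer-≤ : p + q ≤ c → weight (not ∘ (_≡ᵇ k)) m ≤ suc c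
  outer-≤ p+q≤c = m≤n⇒m≤1+n (+-cancelˡ-≤ c _ c (begin
    c + weight (not ∘ (_≡ᵇ k)) m   ≡⟨ weight-not (_≡ᵇ k) m ⟩
    sum m                          ≡⟨ total ⟨
    p + (c + q)                    ≡⟨ rearrange p c q ⟩
    c + (p + q)                    ≤⟨ +-monoʳ-≤ c p+q≤c ⟩
    c + c                          ∎))
    where
    rearrange : ∀ x y z → x + (y + z) ≡ y + (x + z)
    rearrange = solve-∀
  choose : Dec (p + q ≤ c) → p ≤ q ⊎ q ≤ p → Split
  -- The median part dominates: it becomes `W` and everything else `U`.
  choose (yes p+q≤c) _ = split-at (not ∘ (_≡ᵇ k))
    (trans (+-comm _ c) (weight-not (_≡ᵇ k) m)) (outer-≤ p+q≤c) c≤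
  -- Now `c < p + q`. The larger outer group becomes `U`, and the remainder is at most three times
  -- as large.
  choose (no p+q≰c) (inj₁ p≤q) = split-at (k <ᵇ_)
    (trans (rearrange q p c) total) q≤1+p+c (triple-≤ s q (begin
      p + c         ≤⟨ +-monoʳ-≤ p (<⇒≤ (≰⇒> p+q≰c)) ⟩
      p + (p + q)   ≤⟨ +-mono-≤ p≤q (+-monoˡ-≤ q p≤q) ⟩
      q + (q + q)   ∎))
    where
    rearrange : ∀ x y z → x + (y + z) ≡ y + (z + x)
    rearrange = solve-∀
  choose (no p+q≰c) (inj₂ q≤p) = split-at (_<ᵇ k) total (m≤n⇒m≤1+n p≤c+q) (triple-≤ s p (begin
      c + q         ≤⟨ +-monoˡ-≤ q (<⇒≤ (≰⇒> p+q≰c)) ⟩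
      (p + q) + q   ≤⟨ +-mono-≤ (+-monoʳ-≤ p q≤p) q≤p ⟩
      (p + p) + p   ≡⟨ +-assoc p p p ⟩
      p + (p + p)   ∎))

-- Definable total preorders

-- Each comparison used is coarse; antisymmetry is recovered only at the end, by intersecting
-- kernels. `S?` supplies the case distinctions that strictness in `Lex` and totality of `Hoare`
-- require.
record TotalPreorder {X : Set} (S : X → X → Set) : Set where
  field
    total    : ∀ a b → S a b ⊎ S b a
    S-trans  : ∀ {a b c} → S a b → S b c → S a c
    S?       : ∀ a b → Dec (S a b)

  S-refl : ∀ a → S a a
  S-refl a with total a a
  ... | inj₁ p = p
  ... | inj₂ p = p

module _ {X : Set} where

  key-preorder : (κ : X → ℕ) → TotalPreorder (λ a b → κ a ≤ κ b)
  key-preorder κ = record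
    { total = λ a b → ≤-total (κ a) (κ b) ; S-trans = ≤-trans ; S? = λ a b → κ a ≤? κ b }

  flip-preorder : {S : X → X → Set} → TotalPreorder S → TotalPreorder (flip S)
  flip-preorder pre = record
    { total = λ a b → total b a ; S-trans = λ p q → S-trans q p ; S? = λ a b → S? b a }
    where open TotalPreorder pre

  -- Elements outside `P` come before its members. The disjunctive form coincides with the meaning
  -- of `impliesF`.
  Implies : (X → Bool) → X → X → Set
  Implies P a b = ¬ P a ≡ true ⊎ P b ≡ true

  implies-preorder : (P : X → Bool) → TotalPreorder (Implies P)
  implies-preorder P = record
    { total = total
    ; S-trans = λ { (inj₁ p) _ → inj₁ p
                  ; (inj₂ q) (inj₁ p) → contradiction q p
                  ; (inj₂ _) (inj₂ q) → inj₂ q }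
    ; S? = λ a b → ¬? (P a Bool.≟ true) ⊎-dec (P b Bool.≟ true) }
    where
    total : ∀ a b → Implies P a b ⊎ Implies P b a
    total a b with P a in eq
    ... | true  = inj₂ (inj₂ refl)
    ... | false = inj₁ (inj₁ λ ())

  implies-kernel : ∀ {P : X → Bool} {a b} → Implies P a b → Implies P b a → P a ≡ P b
  implies-kernel p q = bool-ext (apply p) (apply q)
    where
    apply : ∀ {A B : Set} → ¬ A ⊎ B → A → B
    apply (inj₁ ¬a) a = contradiction a ¬a
    apply (inj₂ b)  _ = b

  Lex : (X → X → Set) → (X → X → Set) → X → X → Set
  Lex S T a b = S a b × (¬ S b a ⊎ T a b)

  lex-preorder : ∀ {S T} → TotalPreorder S → TotalPreorder T → TotalPreorder (Lex S T)
  lex-preorder {S} {T} preS preT = record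
    { total = total
    ; S-trans = lex-trans
    ; S? = λ a b → S.S? a b ×-dec (¬? (S.S? b a) ⊎-dec T.S? a b) }
    where
    module S = TotalPreorder preS
    module T = TotalPreorder preT
    total : ∀ a b → Lex S T a b ⊎ Lex S T b a
    total a b with S.S? a b | S.S? b a | T.total a b
    ... | yes p | yes q | inj₁ r = inj₁ (p , inj₂ r)
    ... | yes p | yes q | inj₂ r = inj₂ (q , inj₂ r)
    ... | yes p | no ¬q | _      = inj₁ (p , inj₁ ¬q)
    ... | no ¬p | yes q | _      = inj₂ (q , inj₁ ¬p)
    ... | no ¬p | no ¬q | _ with S.total a b
    ...   | inj₁ p = contradiction p ¬p
    ...   | inj₂ q = contradiction q ¬q
    lex-trans : ∀ {a b c} → Lex S T a b → Lex S T b c → Lex S T a c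
    lex-trans (p , inj₁ ¬q) (p′ , _)       = S.S-trans p p′ , inj₁ (¬q ∘ S.S-trans p′)
    lex-trans (p , inj₂ _)  (p′ , inj₁ ¬q) = S.S-trans p p′ , inj₁ (λ r → ¬q (S.S-trans r p))
    lex-trans (p , inj₂ r)  (p′ , inj₂ r′) = S.S-trans p p′ , inj₂ (T.S-trans r r′)

  lex-kernel : ∀ {S T : X → X → Set} {a b} → Lex S T a b → Lex S T b a →
    (S a b × S b a) × (T a b × T b a)
  lex-kernel (p , inj₁ ¬q) (q , _)      = contradiction q ¬q
  lex-kernel (p , inj₂ _)  (q , inj₁ ¬p) = contradiction p ¬p
  lex-kernel (p , inj₂ r)  (q , inj₂ r′) = (p , q) , (r , r′)

  LexAll : ∀ n → (Fin n → X → X → Set) → (X → X → Set) → X → X → Set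
  LexAll zero    S T = T
  LexAll (suc n) S T = Lex (S zero) (LexAll n (S ∘ suc) T)

  lexAll-preorder : ∀ n {S T} → (∀ i → TotalPreorder (S i)) → TotalPreorder T →
    TotalPreorder (LexAll n S T)
  lexAll-preorder zero    preS preT = preT
  lexAll-preorder (suc n) preS preT = lex-preorder (preS zero) (lexAll-preorder n (preS ∘ suc) preT)

  lexAll-kernel : ∀ n {S : Fin n → X → X → Set} {T : X → X → Set} {a b} →
    LexAll n S T a b → LexAll n S T b a →
    (∀ i → S i a b × S i b a) × (T a b × T b a)
  lexAll-kernel zero    p q = (λ ()) , (p , q)
  lexAll-kernel (suc n) {S} {T} {a} {b} p q
    with lex-kernel {S zero} {LexAll n (S ∘ suc) T} {a} {b} p q
  ... | s , p′ , q′ with lexAll-kernel n {S ∘ suc} {T} {a} {b} p′ q′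
  ...   | ss , t = (λ { zero → s ; (suc i) → ss i }) , t

  always-preorder : TotalPreorder {X} (λ _ _ → ⊤)
  always-preorder = record { total = λ _ _ → inj₁ tt ; S-trans = λ _ _ → tt ; S? = λ _ _ → yes tt }

  -- The nesting depth will be `|U|`, which varies with the graph. This form yields the preorder
  -- laws, `Precedes` the definability.
  LexBits : ∀ {n} → (X → Fin n → Bool) → X → X → Set
  LexBits {n} β = LexAll n (λ r → Implies (λ x → β x r)) (λ _ _ → ⊤)

-- First-order form of the lexicographic order: every descent is preceded by an ascent.
Precedes : ∀ {n} → (Fin n → Bool) → (Fin n → Bool) → Set
Precedes β γ = ∀ p → β p ≡ true → γ p ≡ false →
  ∃[ q ] toℕ q < toℕ p × β q ≡ false × γ q ≡ true

precedes-tail : ∀ {n} {β γ : Fin (suc n) → Bool} → β zero ≡ γ zero →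
  Precedes β γ → Precedes (β ∘ suc) (γ ∘ suc)
precedes-tail eq h p βp γp with h (suc p) βp γp
... | zero  , _   , βq , γq = contradiction (trans (≡.sym eq) βq) (true≢false γq)
... | suc q , q<p , βq , γq = q , s≤s⁻¹ q<p , βq , γq

-- If the words differ, their first difference is an ascent, and each descent comes after it.
lexBits-precedes : ∀ {X : Set} n {β : X → Fin n → Bool} {a b} →
  LexBits β a b → Precedes (β a) (β b)
lexBits-precedes zero    h ()
lexBits-precedes (suc n) {β} {a} {b} (s , rest) p βp γp with β a zero in eqa | β b zero in eqb
lexBits-precedes (suc n) (inj₁ ¬p , _) p βp γp | true | false = contradiction refl ¬p
lexBits-precedes (suc n) (inj₂ () , _) p βp γp | true | false
lexBits-precedes (suc n) (s , _) zero    βp γp | false | _ = contradiction βp (λ e → true≢false e eqa)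
lexBits-precedes (suc n) (s , _) (suc p) βp γp | false | true = zero , s≤s z≤n , eqa , eqb
lexBits-precedes (suc n) (s , _) zero    βp γp | true | true = contradiction γp (true≢false eqb)
lexBits-precedes (suc n) (s , inj₁ ¬q) (suc p) βp γp | true | true = contradiction (inj₂ refl) ¬q
lexBits-precedes (suc n) (s , inj₁ ¬q) (suc p) βp γp | false | false = contradiction (inj₁ λ ()) ¬q
lexBits-precedes (suc n) {β} {a} {b} (s , inj₂ rest) (suc p) βp γp | true | true
  with lexBits-precedes n {λ x → β x ∘ suc} {a} {b} rest p βp γp
... | q , q<p , h = suc q , s≤s q<p , h
lexBits-precedes (suc n) {β} {a} {b} (s , inj₂ rest) (suc p) βp γp | false | false
  with lexBits-precedes n {λ x → β x ∘ suc} {a} {b} rest p βp γp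
... | q , q<p , h = suc q , s≤s q<p , h

precedes-lexBits : ∀ {X : Set} n {β : X → Fin n → Bool} {a b} →
  Precedes (β a) (β b) → LexBits β a b
precedes-lexBits zero    h = tt
precedes-lexBits (suc n) {β} {a} {b} h with β a zero in eqa | β b zero in eqb
... | false | true  = inj₁ (λ ()) , inj₁ λ { (inj₁ ¬p) → ¬p refl ; (inj₂ ()) }
... | true  | true  = inj₂ refl , inj₂ (precedes-lexBits n (precedes-tail (trans eqa (≡.sym eqb)) h))
... | false | false = inj₁ (λ ()) , inj₂ (precedes-lexBits n (precedes-tail (trans eqa (≡.sym eqb)) h))
... | true  | false with h zero eqa eqb
-- A descent at position 0 has no earlier position for its ascent.
...   | _ , () , _

-- The Hoare (lower) powerdomain preorder on the sets of incident vertices: for total `S` it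
-- compares the largest endpoints.
Hoare : (A : Structure) → (Fin (size A) → Fin (size A) → Set) → Fin (size A) → Fin (size A) → Set
Hoare A S a b = ∀ x → ¬ rel A x a ≡ true ⊎ ∃[ y ] rel A y b ≡ true × S x y

-- Totality: if some `x` at `a` lies below nothing at `b`, then everything at `b` lies below `x`.
hoare-preorder : ∀ A {S} → TotalPreorder S → TotalPreorder (Hoare A S)
hoare-preorder A {S} pre = record { total = total′ ; S-trans = hoare-trans ; S? = λ a b → all? (below? a b) }
  where
  open TotalPreorder pre
  below? : ∀ a b x → Dec (¬ rel A x a ≡ true ⊎ ∃[ y ] rel A y b ≡ true × S x y)
  below? a b x = ¬? (rel A x a Bool.≟ true) ⊎-dec
    any? (λ y → (rel A y b Bool.≟ true) ×-dec S? x y)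
  hoare-trans : ∀ {a b c} → Hoare A S a b → Hoare A S b c → Hoare A S a c
  hoare-trans h k x with h x
  ... | inj₁ ¬p = inj₁ ¬p
  ... | inj₂ (y , yb , xy) with k y
  ...   | inj₁ ¬p = contradiction yb ¬p
  ...   | inj₂ (z , zc , yz) = inj₂ (z , zc , S-trans xy yz)
  total′ : ∀ a b → Hoare A S a b ⊎ Hoare A S b a
  total′ a b with all? (below? a b)
  ... | yes h = inj₁ h
  ... | no ¬h with ¬∀⟶∃¬ (size A) _ (below? a b) ¬h
  ...   | x , ¬below = inj₂ λ y → dominated y (rel A y b Bool.≟ true)
    where
    dominated : ∀ y → Dec (rel A y b ≡ true) → ¬ rel A y b ≡ true ⊎ ∃[ z ] rel A z a ≡ true × S y z
    dominated y (no ¬p) = inj₁ ¬p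
    dominated y (yes yb) with total x y
    ... | inj₁ xy = contradiction (inj₂ (y , yb , xy)) ¬below
    ... | inj₂ yx = inj₂ (x , decidable-stable (rel A x a Bool.≟ true) (¬below ∘ inj₁) , yx)

-- Uniform in the context and in the names of the two variables, so formulas can be reused under
-- quantifiers without defining substitution.
Formula₂ : ℕ → Set
Formula₂ j = ∀ i → Fin i → Fin i → Formula i j

-- First-order formulas for the preorders

module _ {j : ℕ} where

  impliesF : Fin j → Formula₂ j
  impliesF Z i x y = Or (Not (Mem x Z)) (Mem y Z)

  lexF : Formula₂ j → Formula₂ j → Formula₂ j
  lexF φ ψ i x y = And (φ i x y) (Or (Not (φ i y x)) (ψ i x y))

  lexAllF : ∀ n → (Fin n → Formula₂ j) → Formula₂ j → Formula₂ j
  lexAllF zero    φ ψ = ψ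
  lexAllF (suc n) φ ψ = lexF (φ zero) (lexAllF n (φ ∘ suc) ψ)

  hoareF : Formula₂ j → Formula₂ j
  hoareF φ i x y = All (Or (Not (R zero (suc x)))
    (Ex (And (R zero (suc (suc y))) (φ _ (suc zero) zero))))

  -- The Smyth (upper) preorder, obtained from the Hoare one by reversing both levels; it compares
  -- the smallest endpoints.
  smythF : Formula₂ j → Formula₂ j
  smythF φ i x y = hoareF (λ i → flip (φ i)) i y x

  -- `Z` is read as a graph through its edges. Vertices in `Z` do no harm here, since nothing is
  -- incident to a vertex from the left.
  linkF : Fin j → Formula₂ j
  linkF Z i x y = Ex (And (Mem zero Z) (And (R (suc x) zero) (R (suc y) zero)))

  -- In the half-graph coded by Z, the neighbourhoods of the elements of Y form a chain.
  halfF : (Y Z : Fin j) → Formula₂ j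
  halfF Y Z i x y = All (Or (Not (neighbour (suc x))) (neighbour (suc y)))
    where
    neighbour : Fin (suc i) → Formula (suc i) j
    neighbour x = And (Mem x Y) (And (Not (Mem zero Y)) (linkF Z _ x zero))

  -- `Precedes` with the members of `Y` as positions; the negation of `φ` says that the ascent comes
  -- strictly earlier.
  rowF : Formula₂ j → (Y Z : Fin j) → Formula₂ j
  rowF φ Y Z i x y = All (Or (Not (And (bitF (suc x) zero) (Not (bitF (suc y) zero))))
    (Ex (And (Not (φ _ (suc zero) zero))
      (And (Not (bitF (suc (suc x)) zero)) (bitF (suc (suc y)) zero)))))
    where
    bitF : ∀ {i} → Fin i → Fin i → Formula i j
    bitF x d = And (Mem d Y) (linkF Z _ x d)

-- Set variable 0 stands for U, 1 for the half-graph between U and W, and 2 + i for the i-th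
-- digits of the codes of W.
vertexF : ∀ t → Formula₂ (2 + t)
vertexF t = lexAllF t
  (λ i → lexF (impliesF (suc (suc i))) (rowF (halfF zero (suc zero)) zero (suc (suc i))))
  (lexF (impliesF zero) (halfF zero (suc zero)))

orderF : ∀ t → Formula₂ (2 + t)
orderF t = lexF (vertexF t) (lexF (hoareF (vertexF t)) (smythF (vertexF t)))

module _ {A : Structure} {j : ℕ} {σ : Fin j → Fin (size A) → Bool} where

  record Defines (φ : Formula₂ j) (S : Fin (size A) → Fin (size A) → Set) : Set where
    field
      sound    : ∀ {i} {x y : Fin i} {ρ} → Sat A (φ i x y) ρ σ → S (ρ x) (ρ y)
      complete : ∀ {i} {x y : Fin i} {ρ} → S (ρ x) (ρ y) → Sat A (φ i x y) ρ σ
  open Defines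

  implies-defines : ∀ Z → Defines (impliesF Z) (Implies (σ Z))
  implies-defines Z = record { sound = id ; complete = id }

  flip-defines : ∀ {φ S} → Defines φ S → Defines (λ i → flip (φ i)) (flip S)
  flip-defines d = record { sound = sound d ; complete = complete d }

  lex-defines : ∀ {φ ψ S T} → Defines φ S → Defines ψ T → Defines (lexF φ ψ) (Lex S T)
  lex-defines d e = record
    { sound    = λ { (p , inj₁ ¬q) → sound d p , inj₁ (¬q ∘ complete d)
                   ; (p , inj₂ r)  → sound d p , inj₂ (sound e r) }
    ; complete = λ { (p , inj₁ ¬q) → complete d p , inj₁ (¬q ∘ sound d)
                   ; (p , inj₂ r)  → complete d p , inj₂ (complete e r) } }

  lexAll-defines : ∀ n {φ : Fin n → Formula₂ j} {ψ S T} → (∀ i → Defines (φ i) (S i)) →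
    Defines ψ T → Defines (lexAllF n φ ψ) (LexAll n S T)
  lexAll-defines zero    d e = e
  lexAll-defines (suc n) d e = lex-defines (d zero) (lexAll-defines n (d ∘ suc) e)

  hoare-defines : ∀ {φ S} → Defines φ S → Defines (hoareF φ) (Hoare A S)
  hoare-defines d = record
    { sound    = λ h x → Sum.map₂ (λ (y , yb , s) → y , yb , sound d s) (h x)
    ; complete = λ h x → Sum.map₂ (λ (y , yb , s) → y , yb , complete d s) (h x) }

  smyth-defines : ∀ {φ S} → Defines φ S → Defines (smythF φ) (flip (Hoare A (flip S)))
  smyth-defines d = record { sound = sound h ; complete = complete h }
    where h = hoare-defines (flip-defines d)

-- The order on a split graph

-- The default `false` lets ranks index words without a range proof; ranges matter only for
-- injectivity.
at : ∀ {n} → (Fin n → Bool) → ℕ → Bool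
at {zero}  β r       = false
at {suc n} β zero    = β zero
at {suc n} β (suc r) = at (β ∘ suc) r

at-toℕ : ∀ {n} (β : Fin n → Bool) p → at β (toℕ p) ≡ β p
at-toℕ β zero    = refl
at-toℕ β (suc p) = at-toℕ (β ∘ suc) p

fromBit : Fin 2 → Bool
fromBit zero    = false
fromBit (suc _) = true

fromBit-injective : ∀ {a b} → fromBit a ≡ fromBit b → a ≡ b
fromBit-injective {zero}     {zero}     eq = refl
fromBit-injective {suc zero} {suc zero} eq = refl

decode : ∀ {l} → Fin (2 ^ l) → Fin l → Bool
decode c q = fromBit (finToFun c q)

funToFin-cong : ∀ {k l} {f g : Fin l → Fin k} → (∀ q → f q ≡ g q) → funToFin f ≡ funToFin g
funToFin-cong {l = zero}  eq = refl
funToFin-cong {l = suc l} eq = cong₂ combine (eq zero) (funToFin-cong (eq ∘ suc))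

decode-injective : ∀ {l} {c d : Fin (2 ^ l)} → (∀ q → decode c q ≡ decode d q) → c ≡ d
decode-injective {l} {c} {d} eq = trans (≡.sym (funToFin-finToFin {l} c))
  (trans (funToFin-cong {l = l} (fromBit-injective ∘ eq)) (funToFin-finToFin {l} d))

-- Extending a vertex order to the edges

module ElementOrder (G : Graph) {S : Fin (size ⌈ G ⌉) → Fin (size ⌈ G ⌉) → Set}
         (pre : TotalPreorder S) where

  open Incidence G

  -- The end `h` lies below some end of `f`, and both ends of `f` lie below `h′`. For the reversed
  -- order this treats the smaller ends.
  hoare-top : ∀ {e f l h l′ h′} → Joins e l h → Joins f l′ h′ → S (vtx l′) (vtx h′) →
    Hoare ⌈ G ⌉ S (edg e) (edg f) → S (vtx h) (vtx h′)
  hoare-top {e} {f} {l} {h} {l′} {h′} ej fj l≤h e≤f with e≤f (vtx h)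
  ... | inj₁ ¬he = contradiction (incident-rel (incident-joinsʳ {e} ej)) ¬he
  ... | inj₂ (y , yf , hy) = go (view y) yf hy
    where
    open TotalPreorder pre
    end : ∀ {v} → Joins f l′ h′ → Incident v f → S (vtx v) (vtx h′)
    end (inj₁ (refl , refl)) (inj₁ refl) = l≤h
    end (inj₁ (refl , refl)) (inj₂ refl) = S-refl (vtx h′)
    end (inj₂ (refl , refl)) (inj₁ refl) = S-refl (vtx h′)
    end (inj₂ (refl , refl)) (inj₂ refl) = l≤h
    go : ∀ {y} → View y → rel ⌈ G ⌉ y (edg f) ≡ true → S (vtx h) y → S (vtx h) (vtx h′)
    go (edge g)   yf hy = contradiction (rel-edge g (edg f)) (true≢false yf)
    go (vertex v) yf hy = S-trans hy (end fj (rel-incident yf))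

  sorted-ends : ∀ e → ∃[ l ] ∃[ h ] Joins e l h × S (vtx l) (vtx h)
  sorted-ends e with TotalPreorder.total pre (vtx (src e)) (vtx (tgt e))
  ... | inj₁ p = src e , tgt e , joins-ends e , p
  ... | inj₂ p = tgt e , src e , joins-sym {e} (joins-ends e) , p

  -- An edge has endpoints while nothing is incident to a vertex, so the Hoare comparison separates
  -- the two sorts even where `S` ties them.
  hoare-edge-vertex : ∀ {e v} → ¬ Hoare ⌈ G ⌉ S (edg e) (vtx v)
  hoare-edge-vertex {e} {v} h with h (vtx (src e))
  ... | inj₁ ¬p           = ¬p (incident-rel (inj₁ refl))
  ... | inj₂ (y , yv , _) = true≢false yv (rel-vertex y v)

  -- Edges are compared by their larger endpoints (Hoare), then by their smaller ones (Smyth).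
  ElementLex : X → X → Set
  ElementLex = Lex S (Lex (Hoare ⌈ G ⌉ S) (flip (Hoare ⌈ G ⌉ (flip S))))

  element-preorder : TotalPreorder ElementLex
  element-preorder = lex-preorder pre (lex-preorder (hoare-preorder ⌈ G ⌉ pre)
    (flip-preorder (hoare-preorder ⌈ G ⌉ (flip-preorder pre))))

module ElementAntisym (G : Graph) {S : Fin (size ⌈ G ⌉) → Fin (size ⌈ G ⌉) → Set}
         (pre : TotalPreorder S)
         (antisym : (u v : Fin (n G)) → S (Incidence.vtx G u) (Incidence.vtx G v) →
                    S (Incidence.vtx G v) (Incidence.vtx G u) → u ≡ v) where

  open Incidence G
  open ElementOrder G pre
  module Flipped = ElementOrder G (flip-preorder pre)

  edge-antisym : ∀ {e f} →
    Hoare ⌈ G ⌉ S (edg e) (edg f) → Hoare ⌈ G ⌉ S (edg f) (edg e) →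
    Hoare ⌈ G ⌉ (flip S) (edg f) (edg e) → Hoare ⌈ G ⌉ (flip S) (edg e) (edg f) → e ≡ f
  edge-antisym {e} {f} h₁ h₂ s₁ s₂ with sorted-ends e | sorted-ends f
  ... | l , h , ej , l≤h | l′ , h′ , fj , l′≤h′ =
    joins-unique ej (subst₂ (Joins f) (≡.sym l≡l′) (≡.sym h≡h′) fj)
    where
    ej′ = joins-sym {e} {l} {h} ej
    fj′ = joins-sym {f} {l′} {h′} fj
    h≡h′ : h ≡ h′
    h≡h′ = antisym h h′ (hoare-top {e} {f} {l} {h} {l′} {h′} ej fj l′≤h′ h₁)
      (hoare-top {f} {e} {l′} {h′} {l} {h} fj ej l≤h h₂)
    l≡l′ : l ≡ l′
    l≡l′ = antisym l l′ (Flipped.hoare-top {f} {e} {h′} {l′} {h} {l} fj′ ej′ l≤h s₁)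
      (Flipped.hoare-top {e} {f} {h} {l} {h′} {l′} ej′ fj′ l′≤h′ s₂)

  element-antisym : ∀ {a b} → ElementLex a b → ElementLex b a → a ≡ b
  element-antisym {a} {b} p q
    with lex-kernel {S = S} {T = Lex (Hoare ⌈ G ⌉ S) (flip (Hoare ⌈ G ⌉ (flip S)))} {a} {b} p q
  ... | (v₁ , v₂) , (l₁ , l₂)
    with lex-kernel {S = Hoare ⌈ G ⌉ S} {T = flip (Hoare ⌈ G ⌉ (flip S))} {a} {b} l₁ l₂
  ... | (h₁ , h₂) , (s₁ , s₂) = go (view a) (view b) v₁ v₂ h₁ h₂ s₁ s₂
    where
    go : ∀ {a b} → View a → View b → S a b → S b a →
      Hoare ⌈ G ⌉ S a b → Hoare ⌈ G ⌉ S b a →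
      Hoare ⌈ G ⌉ (flip S) b a → Hoare ⌈ G ⌉ (flip S) a b → a ≡ b
    go (vertex u) (vertex v) v₁ v₂ _ _ _ _ = cong vtx (antisym u v v₁ v₂)
    go (vertex u) (edge e)   _ _ _ h₂ _ _ = contradiction h₂ (hoare-edge-vertex {e} {u})
    go (edge e)   (vertex u) _ _ h₁ _ _ _ = contradiction h₁ (hoare-edge-vertex {e} {u})
    go (edge e)   (edge f)   _ _ h₁ h₂ s₁ s₂ = cong edg (edge-antisym h₁ h₂ s₁ s₂)

-- Coding the vertex order by parameters

module SplitOrder (G : Graph) (U : Fin (n G) → Bool)
         (across : (u v : Fin (n G)) → U u ≢ U v → adj G u v ≡ true)
         (t : ℕ) (small : count U ≤ suc (count (not ∘ U)))
         (coded : count (not ∘ U) ≤ 2 ^ (t * suc (count U))) where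

  open Incidence G
  open Defines

  A : Structure
  A = ⌈ G ⌉

  W : V → Bool
  W = not ∘ U

  onElements : ∀ {B : Set} → (V → B) → (E → B) → X → B
  onElements p q x = [ p , q ]′ (splitAt (n G) x)

  onElements-vtx : ∀ {B : Set} (p : V → B) q v → onElements p q (vtx v) ≡ p v
  onElements-vtx p q v rewrite splitAt-↑ˡ (n G) v (length (edges G)) = refl

  onElements-edg : ∀ {B : Set} (p : V → B) q e → onElements p q (edg e) ≡ q e
  onElements-edg p q e rewrite splitAt-↑ʳ (n G) (length (edges G)) e = refl

  cross : (V → V → Bool) → V → V → Bool
  cross h d w = U d ∧ (W w ∧ h d w)

  -- Edges are stored without regard to the sides, so both orientations are tried; at most one runs
  -- from `U` to `W`, and edges inside a side stay unmarked.
  mark : (V → Bool) → (V → V → Bool) → X → Bool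
  mark h₀ h = onElements h₀ (λ e → cross h (src e) (tgt e) ∨ cross h (tgt e) (src e))

  mark-joins : ∀ h₀ h {e d w} → U d ≡ true → U w ≡ false → Joins e d w → mark h₀ h (edg e) ≡ h d w
  mark-joins h₀ h {e} {d} {w} Ud Uw j = trans (onElements-edg h₀ _ e) (oriented j)
    where
    forth : cross h d w ≡ h d w
    forth rewrite Ud | Uw = refl
    back : cross h w d ≡ false
    back rewrite Uw = refl
    oriented : Joins e d w → cross h (src e) (tgt e) ∨ cross h (tgt e) (src e) ≡ h d w
    oriented (inj₁ (refl , refl)) = trans (cong₂ _∨_ forth back) (∨-identityʳ _)
    oriented (inj₂ (refl , refl)) = cong₂ _∨_ back forth

  Linked : (X → Bool) → X → X → Set
  Linked Z a b = ∃[ e ] Z e ≡ true × rel A a e ≡ true × rel A b e ≡ true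

  linked-sym : ∀ {Z a b} → Linked Z a b → Linked Z b a
  linked-sym (e , Ze , ae , be) = e , Ze , be , ae

  module _ (h₀ : V → Bool) (h : V → V → Bool) {d w : V} (Ud : U d ≡ true) (Uw : U w ≡ false) where

    private
      d≢w : d ≢ w
      d≢w refl = true≢false Ud Uw

    linked-mark : Linked (mark h₀ h) (vtx d) (vtx w) → h d w ≡ true
    linked-mark (x , Zx , dx , wx) = go (view x) Zx dx wx
      where
      go : ∀ {x} → View x → mark h₀ h x ≡ true → rel A (vtx d) x ≡ true →
        rel A (vtx w) x ≡ true → h d w ≡ true
      go (vertex v) Zx dx wx = contradiction (rel-vertex (vtx d) v) (true≢false dx)
      go (edge e)   Zx dx wx = trans (≡.sym (mark-joins h₀ h Ud Uw
        (joins-incident d≢w (rel-incident dx) (rel-incident wx)))) Zx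

    mark-linked : h d w ≡ true → Linked (mark h₀ h) (vtx d) (vtx w)
    mark-linked hdw with edge-between d w (across d w (λ eq → true≢false Ud (trans eq Uw)))
    ... | e , j = edg e , trans (mark-joins h₀ h Ud Uw j) hdw ,
      incident-rel (incident-joinsˡ {e} j) , incident-rel (incident-joinsʳ {e} j)

  code : V → Fin (t * suc (count U)) → Bool
  code w q = at (λ c → decode c q) (rank W w)

  -- The code of `w` is its rank in binary, cut into `t` blocks of length `|U| + 1`. Digit 0 of a
  -- block is stored at `w`, digit `r + 1` at the edge to the member of `U` of rank `r`.
  codeBit : Fin t → V → ℕ → Bool
  codeBit i w r = at (λ p → code w (combine i p)) r

  code-injective : ∀ {v w} → W v ≡ true → W w ≡ true →
    (∀ i p → codeBit i v (toℕ p) ≡ codeBit i w (toℕ p)) → v ≡ w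
  code-injective {v} {w} Wv Ww eq = rank-injective W Wv Ww
    (trans (≡.sym (toℕ-fromℕ< (in-range Wv)))
      (trans (cong toℕ (decode-injective (λ q → trans (decoded Wv q) (trans (same q) (≡.sym (decoded Ww q))))))
        (toℕ-fromℕ< (in-range Ww))))
    where
    in-range : ∀ {v} → W v ≡ true → rank W v < 2 ^ (t * suc (count U))
    in-range Wv = <-≤-trans (rank-< W Wv) coded
    decoded : ∀ {v} (Wv : W v ≡ true) q → decode (fromℕ< (in-range Wv)) q ≡ code v q
    decoded Wv q = trans (≡.sym (at-toℕ (λ c → decode c q) (fromℕ< (in-range Wv))))
      (cong (at (λ c → decode c q)) (toℕ-fromℕ< (in-range Wv)))
    same : ∀ q → code v q ≡ code w q
    same q = subst (λ q → code v q ≡ code w q) (combine-remQuot {t} (suc (count U)) q)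
      (let i , p = remQuot {t} (suc (count U)) q in
        trans (≡.sym (at-toℕ (λ p → code v (combine i p)) p))
          (trans (eq i p) (at-toℕ (λ p → code w (combine i p)) p)))

  -- The half-graph: a vertex of rank `r` in `U` sees the first `r` vertices of `W`, so rank 0 sees
  -- none.
  lower : V → V → Bool
  lower d w = rank W w <ᵇ rank U d

  digit : Fin t → V → V → Bool
  digit i d w = codeBit i w (suc (rank U d))

  σ : Fin (2 + t) → X → Bool
  σ zero          = onElements U (const false)
  σ (suc zero)    = mark (const false) lower
  σ (suc (suc i)) = mark (λ w → codeBit i w 0) (digit i)

  σ₀-vtx : ∀ v → σ zero (vtx v) ≡ U v
  σ₀-vtx = onElements-vtx U (const false)

  σ₀-edg : ∀ e → σ zero (edg e) ≡ false
  σ₀-edg = onElements-edg U (const false)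

  -- The number of half-graph neighbours. Elements outside `U` have none, hence the value 0.
  κ : X → ℕ
  κ = onElements (λ v → if U v then rank U v else 0) (const 0)

  κ-vtx : ∀ {v} → U v ≡ true → κ (vtx v) ≡ rank U v
  κ-vtx {v} Uv = trans (onElements-vtx _ _ v) (cong (λ b → if b then rank U v else 0) Uv)

  Neighbour : X → X → Set
  Neighbour a c = σ zero a ≡ true × ¬ σ zero c ≡ true × Linked (σ (suc zero)) a c

  neighbour-lower : ∀ {a c} → Neighbour a c → ∃[ w ] c ≡ vtx w × rank W w < κ a
  neighbour-lower {a} {c} = go (view a) (view c)
    where
    go : ∀ {a c} → View a → View c → Neighbour a c → ∃[ w ] c ≡ vtx w × rank W w < κ a
    go (edge e) _ (σa , _) = contradiction (σ₀-edg e) (true≢false σa)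
    go (vertex d) (edge e) (_ , _ , x , _ , _ , ex) = contradiction (rel-edge e x) (true≢false ex)
    go (vertex d) (vertex w) (σd , ¬σw , link) = w , refl ,
      subst (rank W w <_) (≡.sym (κ-vtx Ud))
        (<ᵇ⇒< _ _ (to-T (linked-mark (const false) lower Ud Uw link)))
      where
      Ud : U d ≡ true
      Ud = trans (≡.sym (σ₀-vtx d)) σd
      Uw : U w ≡ false
      Uw = ¬-not (λ eq → ¬σw (trans (σ₀-vtx w) eq))

  lower-neighbour : ∀ {a w} → U w ≡ false → rank W w < κ a → Neighbour a (vtx w)
  lower-neighbour {a} {w} Uw = go (view a)
    where
    go : ∀ {a} → View a → rank W w < κ a → Neighbour a (vtx w)
    go (edge e) r< with () ← subst (rank W w <_) (onElements-edg _ (const 0) e) r<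
    go (vertex d) r< with U d in Ud
    ... | false with () ← subst (rank W w <_)
      (trans (onElements-vtx _ (const 0) d) (cong (λ b → if b then rank U d else 0) Ud)) r<
    ... | true = trans (σ₀-vtx d) Ud ,
      (λ σw → true≢false (trans (≡.sym (σ₀-vtx w)) σw) Uw) ,
      mark-linked (const false) lower Ud Uw (from-T (<⇒<ᵇ (subst (rank W w <_) (κ-vtx Ud) r<)))

  -- A rank in `U` is at most `|U| - 1`, which `small` bounds by `|W|`: every threshold is realised.
  κ≤count : ∀ {a r} → r < κ a → r < count W
  κ≤count {a} {r} = go (view a)
    where
    go : ∀ {a} → View a → r < κ a → r < count W
    go (edge e) r< with () ← subst (r <_) (onElements-edg _ (const 0) e) r<
    go (vertex d) r< with U d in Ud
    ... | false with () ← subst (r <_)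
      (trans (onElements-vtx _ (const 0) d) (cong (λ b → if b then rank U d else 0) Ud)) r<
    ... | true = <-≤-trans (subst (r <_) (κ-vtx Ud) r<) (s≤s⁻¹ (≤-trans (rank-< U Ud) small))

  κ≤-neighbours : ∀ {a b} → κ a ≤ κ b → ∀ c → ¬ Neighbour a c ⊎ Neighbour b c
  κ≤-neighbours {a} {b} a≤b c = go (view c)
    where
    go : ∀ {c} → View c → ¬ Neighbour a c ⊎ Neighbour b c
    go (edge e) = inj₁ λ { (_ , _ , x , _ , _ , ex) → true≢false ex (rel-edge e x) }
    go (vertex w) with U w in Uw
    ... | true = inj₁ λ { (_ , ¬σw , _) → ¬σw (trans (σ₀-vtx w) Uw) }
    ... | false with rank W w <? κ a
    ...   | yes r< = inj₂ (lower-neighbour Uw (<-≤-trans r< a≤b))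
    ...   | no ¬r< = inj₁ λ nb → let w′ , eq , r< = neighbour-lower nb in
      ¬r< (subst (λ w → rank W w < κ a) (≡.sym (↑ˡ-injective _ w w′ eq)) r<)

  -- If `κ b < κ a`, the vertex of `W` with rank `κ b` is a neighbour of `a` but not of `b`.
  neighbours-κ≤ : ∀ {a b} → (∀ c → ¬ Neighbour a c ⊎ Neighbour b c) → κ a ≤ κ b
  neighbours-κ≤ {a} {b} h = ≮⇒≥ absurd
    where
    absurd : ¬ κ b < κ a
    absurd b<a with unrank W (κ≤count {a} b<a)
    ... | w , Ww , rw with h (vtx w)
    ...   | inj₁ ¬nb = ¬nb (lower-neighbour (not-true Ww) (subst (_< κ a) (≡.sym rw) b<a))
    ...   | inj₂ nb with neighbour-lower nb
    ...     | w′ , eq , r< = <-irrefl rw (subst (λ w → rank W w < κ b) (≡.sym (↑ˡ-injective _ w w′ eq)) r<)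

  half-defines : Defines {A} {σ = σ} (halfF zero (suc zero)) (λ a b → κ a ≤ κ b)
  half-defines = record { sound = neighbours-κ≤ ; complete = κ≤-neighbours }

  ν : Fin (count U) → X
  ν r = vtx (proj₁ (unrank U (toℕ<n r)))

  σ₀-ν : ∀ r → σ zero (ν r) ≡ true
  σ₀-ν r = trans (σ₀-vtx _) (proj₁ (proj₂ (unrank U (toℕ<n r))))

  κ-ν : ∀ r → κ (ν r) ≡ toℕ r
  κ-ν r with unrank U (toℕ<n r)
  ... | u , Uu , ru = trans (κ-vtx Uu) ru

  vtx-ν : ∀ {u} → U u ≡ true → ∃[ r ] vtx u ≡ ν r × toℕ r ≡ rank U u
  vtx-ν {u} Uu with fromℕ< (rank-< U Uu) | toℕ-fromℕ< (rank-< U Uu)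
  ... | r | eq = r , cong vtx (let v , Uv , rv = unrank U (toℕ<n r) in
    rank-injective U Uu Uv (trans (≡.sym eq) (≡.sym rv))) , eq

  σ₀-surjective : ∀ {d} → σ zero d ≡ true → ∃[ r ] d ≡ ν r
  σ₀-surjective {d} = go (view d)
    where
    go : ∀ {d} → View d → σ zero d ≡ true → ∃[ r ] d ≡ ν r
    go (edge e)   σe = contradiction (σ₀-edg e) (true≢false σe)
    go (vertex u) σu with vtx-ν (trans (≡.sym (σ₀-vtx u)) σu)
    ... | r , eq , _ = r , eq

  -- Evaluating the formula makes `Linked` Boolean, as `LexBits` requires.
  row : Fin (2 + t) → X → Fin (count U) → Bool
  row Z a r = eval A (linkF Z 2 zero (suc zero)) (a ∷ᶠ ν r ∷ᶠ []ᶠ) σ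

  row-sound : ∀ Z {a r} → row Z a r ≡ true → Linked (σ Z) a (ν r)
  row-sound Z {a} {r} = eval-sound A (linkF Z 2 zero (suc zero)) {a ∷ᶠ ν r ∷ᶠ []ᶠ} {σ}

  row-complete : ∀ Z {a r} → Linked (σ Z) a (ν r) → row Z a r ≡ true
  row-complete Z {a} {r} = eval-complete A (linkF Z 2 zero (suc zero)) {a ∷ᶠ ν r ∷ᶠ []ᶠ} {σ}

  module _ (Z : Fin (2 + t)) where

    private
      Bit : X → X → Set
      Bit a d = σ zero d ≡ true × Linked (σ Z) a d

      Row : X → X → Set
      Row a b = ∀ d → ¬ (Bit a d × ¬ Bit b d) ⊎
        ∃[ d′ ] ¬ κ d ≤ κ d′ × ¬ Bit a d′ × Bit b d′

      no-bit : ∀ {a r} → row Z a r ≡ false → ¬ Bit a (ν r)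
      no-bit eq (_ , l) = true≢false (row-complete Z l) eq

      no-row : ∀ {a r} → ¬ Bit a (ν r) → row Z a r ≡ false
      no-row ¬bit = ¬-not (λ eq → ¬bit (σ₀-ν _ , row-sound Z eq))

      row-precedes : ∀ {a b} → Row a b → Precedes (row Z a) (row Z b)
      row-precedes h p ap bp with h (ν p)
      ... | inj₁ ¬descent = contradiction ((σ₀-ν p , row-sound Z ap) , no-bit bp) ¬descent
      ... | inj₂ (d , κ< , ¬ad , bd@(σd , lbd)) with σ₀-surjective σd
      ...   | q , refl = q , subst₂ _<_ (κ-ν q) (κ-ν p) (≰⇒> κ<) , no-row ¬ad , row-complete Z lbd

      precedes-row : ∀ {a b} → Precedes (row Z a) (row Z b) → Row a b
      precedes-row {a} {b} h d with σ zero d Bool.≟ true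
      ... | no ¬σd = inj₁ λ ((σd , _) , _) → ¬σd σd
      ... | yes σd with σ₀-surjective σd
      ...   | p , refl with row Z a p in ap | row Z b p in bp
      ...     | false | _    = inj₁ λ (bit , _) → no-bit ap bit
      ...     | true  | true = inj₁ λ (_ , ¬bit) → ¬bit (σd , row-sound Z bp)
      ...     | true  | false with h p ap bp
      ...       | q , q<p , aq , bq = inj₂ (ν q ,
        <⇒≱ (subst₂ _<_ (≡.sym (κ-ν q)) (≡.sym (κ-ν p)) q<p) , no-bit aq , (σ₀-ν q , row-sound Z bq))

    row-defines : Defines {A} {σ = σ} (rowF (halfF zero (suc zero)) zero Z) (LexBits (row Z))
    row-defines = record
      { sound    = λ h → precedes-lexBits (count U) (row-precedes λ d →
          Sum.map₂ (λ (d′ , ¬half , bits) → d′ , ¬half ∘ κ≤-neighbours {d} {d′} , bits) (h d))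
      ; complete = λ h d →
          Sum.map₂ (λ (d′ , ¬half , bits) → d′ , ¬half ∘ neighbours-κ≤ {d} {d′} , bits)
            (precedes-row (lexBits-precedes (count U) h) d) }

  Digits : Fin t → X → X → Set
  Digits i = Lex (Implies (σ (suc (suc i)))) (LexBits (row (suc (suc i))))

  Base : X → X → Set
  Base = Lex (Implies (σ zero)) (λ a b → κ a ≤ κ b)

  VertexOrder : X → X → Set
  VertexOrder = LexAll t Digits Base

  vertex-defines : Defines {A} {σ = σ} (vertexF t) VertexOrder
  vertex-defines = lexAll-defines t
    (λ i → lex-defines (implies-defines (suc (suc i))) (row-defines (suc (suc i))))
    (lex-defines (implies-defines zero) half-defines)

  vertex-preorder : TotalPreorder VertexOrder
  vertex-preorder = lexAll-preorder t
    (λ i → lex-preorder (implies-preorder (σ (suc (suc i))))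
      (lexAll-preorder (count U) (λ r → implies-preorder (λ x → row (suc (suc i)) x r)) always-preorder))
    (lex-preorder (implies-preorder (σ zero)) (key-preorder κ))

  row-digit : ∀ i {w} → U w ≡ false → ∀ r →
    row (suc (suc i)) (vtx w) r ≡ codeBit i w (toℕ (suc r))
  row-digit i {w} Uw r = bool-ext
    (λ h → subst (λ r → codeBit i w (suc r) ≡ true) rd
      (linked-mark (λ w → codeBit i w 0) (digit i) Ud Uw (linked-sym (row-sound (suc (suc i)) h))))
    (λ h → row-complete (suc (suc i))
      (linked-sym (mark-linked (λ w → codeBit i w 0) (digit i) Ud Uw
        (subst (λ r → codeBit i w (suc r) ≡ true) (≡.sym rd) h))))
    where
    Ud = proj₁ (proj₂ (unrank U (toℕ<n r)))
    rd = proj₂ (proj₂ (unrank U (toℕ<n r)))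

  -- Mutual comparison is a tie in every component. The tie in `σ zero` puts both vertices on one
  -- side; there `κ` separates members of `U`, and the digits separate members of `W`.
  vertex-antisym : ∀ u v → VertexOrder (vtx u) (vtx v) → VertexOrder (vtx v) (vtx u) → u ≡ v
  vertex-antisym u v p q with lexAll-kernel t {Digits} {Base} {vtx u} {vtx v} p q
  ... | digits , base , base′
    with lex-kernel {S = Implies (σ zero)} {T = λ a b → κ a ≤ κ b} {vtx u} {vtx v} base base′
  ... | (σ₁ , σ₂) , (κ₁ , κ₂) = go (U u) refl
    where
    Uu≡Uv : U u ≡ U v
    Uu≡Uv = trans (≡.sym (σ₀-vtx u)) (trans (implies-kernel {P = σ zero} {vtx u} {vtx v} σ₁ σ₂) (σ₀-vtx v))
    same-digit : ∀ i → U u ≡ false → ∀ p → codeBit i u (toℕ p) ≡ codeBit i v (toℕ p)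
    same-digit i Uu p
      with lex-kernel {S = Implies (σ (suc (suc i)))} {T = LexBits (row (suc (suc i)))} {vtx u} {vtx v}
        (proj₁ (digits i)) (proj₂ (digits i))
    same-digit i Uu zero | (s , s′) , _ = trans (≡.sym (onElements-vtx _ _ u))
      (trans (implies-kernel {P = σ (suc (suc i))} {vtx u} {vtx v} s s′) (onElements-vtx _ _ v))
    same-digit i Uu (suc r) | _ , (l , l′)
      with lexAll-kernel (count U) {λ r → Implies (λ x → row (suc (suc i)) x r)} {λ _ _ → ⊤} {vtx u} {vtx v} l l′
    ... | bits , _ = trans (≡.sym (row-digit i Uu r))
      (trans (implies-kernel {P = λ x → row (suc (suc i)) x r} {vtx u} {vtx v} (proj₁ (bits r)) (proj₂ (bits r)))
        (row-digit i (trans (≡.sym Uu≡Uv) Uu) r))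
    go : ∀ b → U u ≡ b → u ≡ v
    go true Uu = rank-injective U Uu Uv
      (trans (≡.sym (κ-vtx Uu)) (trans (≤-antisym κ₁ κ₂) (κ-vtx Uv)))
      where Uv = trans (≡.sym Uu≡Uv) Uu
    go false Uu = code-injective (not-intro Uu) (not-intro (trans (≡.sym Uu≡Uv) Uu))
      (λ i → same-digit i Uu)

  open ElementOrder G vertex-preorder
  open ElementAntisym G vertex-preorder vertex-antisym

  order-defines : Defines {A} {σ = σ} (orderF t) ElementLex
  order-defines = lex-defines vertex-defines
    (lex-defines (hoare-defines vertex-defines) (smyth-defines vertex-defines))

  totally-ordered : IsTotalOrder _≡_
    (λ a b → eval A (orderF t 2 zero (suc zero)) (a ∷ᶠ b ∷ᶠ []ᶠ) σ ≡ true)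
  totally-ordered = record
    { isPartialOrder = record
      { isPreorder = record
        { isEquivalence = ≡.isEquivalence
        ; reflexive     = λ { refl → holds (S-refl _) }
        ; trans         = λ p q → holds (S-trans (order p) (order q)) }
      ; antisym = λ p q → element-antisym (order p) (order q) }
    ; total = λ a b → Sum.map holds holds (total a b) }
    where
    open TotalPreorder element-preorder
    order : ∀ {a b} → eval A (orderF t 2 zero (suc zero)) (a ∷ᶠ b ∷ᶠ []ᶠ) σ ≡ true → ElementLex a b
    order {a} {b} h = sound order-defines {ρ = a ∷ᶠ b ∷ᶠ []ᶠ}
      (eval-sound A (orderF t 2 zero (suc zero)) {a ∷ᶠ b ∷ᶠ []ᶠ} {σ} h)
    holds : ∀ {a b} → ElementLex a b → eval A (orderF t 2 zero (suc zero)) (a ∷ᶠ b ∷ᶠ []ᶠ) σ ≡ true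
    holds {a} {b} s = eval-complete A (orderF t 2 zero (suc zero)) {a ∷ᶠ b ∷ᶠ []ᶠ} {σ}
      (complete order-defines {ρ = a ∷ᶠ b ∷ᶠ []ᶠ} s)

maxPart-≤-sum : ∀ m → maxPart m ≤ sum m
maxPart-≤-sum m with largest-part m
... | i , eq = subst₂ _≤_ eq (weight-not (_≡ᵇ i) m) (m≤m+n _ _)

bounded⇒orderable : ∀ {C} → Bounded C → MSO₂-orderable C
-- The parameters are `U`, the half-graph and `2 + s` digit sets.
bounded⇒orderable (s , bound) = 2 + (2 + s) , orderF (2 + s) 2 zero (suc zero) , ordered
  where
  ordered : ∀ m → _ → 0 < sum m → ∃[ P ] IsTotalOrder _≡_
    (λ a b → eval ⌈ K m ⌉ (orderF (2 + s) 2 zero (suc zero)) (a ∷ᶠ b ∷ᶠ []ᶠ) P ≡ true)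
  ordered m Cm _ with balanced-split s m (bound m Cm)
  ... | f , small , coded = σ , totally-ordered
    where
    open SplitOrder (K m) (f ∘ partOf m)
      (λ u v Uu≢Uv → other-part-adj m {u} {v} (Uu≢Uv ∘ cong f)) (2 + s)
      (subst₂ (λ u w → u ≤ suc w) (≡.sym (count-parts f m)) (≡.sym (count-parts (not ∘ f) m)) small)
      (subst₂ (λ u w → w ≤ 2 ^ ((2 + s) * suc u)) (≡.sym (count-parts f m))
        (≡.sym (count-parts (not ∘ f) m)) coded)

theorem4p29 : (C : List ℕ → Set) →
    (MSO₂-orderable C ⇔ SEP-class C) × (SEP-class C ⇔ Bounded C)
theorem4p29 C =
  mk⇔ (from ∘ orderable⇒Bounded) (bounded⇒orderable ∘ to) , SEP⇔Bounded C
  where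
  open Equivalence (SEP⇔Bounded C) using (to; from)
  orderable⇒Bounded : MSO₂-orderable C → Bounded C
  orderable⇒Bounded (k , φ , orderable) = k , bounded
    where
    bounded : ∀ m → C m → maxPart m ≤ 2 ^ (k * (sum m ∸ maxPart m + 1))
    bounded m Cm with 0 <? sum m
    ... | yes 0<n = let P , order = orderable m Cm 0<n in total-order⇒bounded φ m P order
    -- Orderability says nothing about the empty graph, but there `M = 0`.
    ... | no  0≮n = ≤-trans (≤-trans (maxPart-≤-sum m) (≮⇒≥ 0≮n)) z≤n
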